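{- Let $m\geq 4$ be even. There exists a constant $C_m>0$ (depending only on $m$) such that for all integers $n\ge 1$ $$ r_3(\mathbb{Z}_m^n) \geq \frac{C_m}{\sqrt{n}}\left(\frac{m+2}{2}\right)^n.$$ With $\sigma_m = \sqrt{\frac{m^4+8m^3+4m^2-48m}{2880}}$ one can choose $C_m=\frac{1}{3\sqrt{3}\,\sigma_m}$. With this choice, as $m\to\infty$ through even values, $C_m \sim \frac{8 \sqrt{5}}{\sqrt{3}\, m^2}$.
   Context: $\mathbb{Z}_m^n$ denotes the additive group $(\mathbb{Z}/m\mathbb{Z})^n$. A proper arithmetic progression of length $k$ in $\mathbb{Z}_m^n$ is a sequence $x, x+d, \ldots, x+(k-1)d$ (with $x,d\in\mathbb{Z}_m^n$) whose $k$ elements are pairwise distinct. $r_k(\mathbb{Z}_m^n)$ denotes the maximal size of a set $S\subseteq\mathbb{Z}_m^n$ that does not contain a proper arithmetic progression of length $k$. -}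

module Defs where

open import Data.Empty using (⊥-elim)
open import Data.Fin.Base as Fin using (Fin; zero; suc; toℕ; combine)
open import Data.Fin.Properties as Fin using (combine-injective; injective⇒≤; nonZeroIndex; any?; all?)
open import Data.Integer.Base as ℤ using (+_)
import Data.Integer.Properties as ℤ
open import Data.Nat.Base as ℕ using (ℕ; zero; suc; NonZero; z≤n; s≤s)
open import Data.Nat.DivMod using (_mod_)
import Data.Nat.Properties as ℕ
open import Data.Product.Base using (Σ; ∃; ∃₂; _×_; _,_; proj₁; proj₂)
open import Data.Rational.Base as ℚ using (ℚ; 0ℚ; 1ℚ; ½; _<_; _+_; _-_; Positive; 1/_; ↥_)
open import Data.Rational.Properties as ℚ using (positive⁻¹; pos⇒nonZero; 1/pos⇒pos; *-inverseʳ)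
import Data.Rational.Unnormalised.Base as ℚᵘ
import Data.Rational.Unnormalised.Properties as ℚᵘ
open import Data.Rational.Solver using (module +-*-Solver)
open import Data.Sum.Base as Sum using (_⊎_; inj₁; inj₂; swap)
open import Data.Vec.Base using (Vec; []; _∷_; zipWith; replicate; lookup)
open import Data.Vec.Membership.Propositional using (_∈_)
open import Data.Vec.Properties using (≡-dec)
open import Data.Vec.Relation.Unary.All using ([])
open import Data.Vec.Relation.Unary.AllPairs using (allPairs?; []; _∷_)
open import Data.Vec.Relation.Unary.Any using (here)
open import Data.Vec.Relation.Unary.Unique.Propositional using (Unique)
open import Data.Vec.Relation.Unary.Unique.Propositional.Properties using (lookup-injective)
open import Function.Definitions using (Injective)
open import Relation.Binary.Definitions using (DecidableEquality)
open import Relation.Binary.PropositionalEquality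
  using (_≡_; refl; sym; trans; cong; cong₂; subst)
open import Relation.Nullary using (¬_; Dec; yes; no; contradiction; ¬?)
open import Relation.Nullary.Decidable using (map′; _×-dec_)
open import Relation.Unary using (Decidable)
import Data.Vec.Membership.DecPropositional as DecMembership

------------------------------------------------------------------------
-- Progression-free subsets of (ℤ/mℤ)ⁿ

ℤ[_]^_ : ℕ → ℕ → Set
ℤ[ m ]^ n = Vec (Fin m) n

_+ₘ_ : ∀ {m} → Fin m → Fin m → Fin m
_+ₘ_ {m} i j = _mod_ (toℕ i ℕ.+ toℕ j) m {{nonZeroIndex i}}

_⊕_ : ∀ {m n} → ℤ[ m ]^ n → ℤ[ m ]^ n → ℤ[ m ]^ n
_⊕_ = zipWith _+ₘ_

-- term x d i is x + i·d.
term : ∀ {m n} → ℤ[ m ]^ n → ℤ[ m ]^ n → ℕ → ℤ[ m ]^ n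
term x d zero    = x
term x d (suc i) = term x d i ⊕ d

-- The elements of a finite set are listed, without repetition, by a vector
-- whose length is the size of the set.
ContainsProperAP : ∀ {m n s} → ℕ → Vec (ℤ[ m ]^ n) s → Set
ContainsProperAP {m} {n} k S = ∃₂ λ (x d : ℤ[ m ]^ n) →
  Injective _≡_ _≡_ (λ (i : Fin k) → term x d (toℕ i)) ×
  (∀ (i : Fin k) → term x d (toℕ i) ∈ S)

HasAPFreeSetOfSize : ℕ → ℕ → ℕ → ℕ → Set
HasAPFreeSetOfSize k m n s =
  Σ (Vec (ℤ[ m ]^ n) s) λ S → Unique S × ¬ ContainsProperAP k S

IsMaximum : (ℕ → Set) → ℕ → Set
IsMaximum P r = P r × (∀ s → P s → s ℕ.≤ r)

private
  Searchable : Set → Set₁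
  Searchable A = ∀ {P : A → Set} → Decidable P → Dec (∃ P)

  search-Vec : ∀ {A} → Searchable A → ∀ n → Searchable (Vec A n)
  search-Vec _ zero P? = map′ ([] ,_) (λ { ([] , p) → p }) (P? [])
  search-Vec f (suc n) P? =
    map′ (λ { (x , xs , p) → x ∷ xs , p }) (λ { (x ∷ xs , p) → x , xs , p })
      (f (λ x → search-Vec f n (λ xs → P? (x ∷ xs))))

  injective? : ∀ {A : Set} → DecidableEquality A → ∀ {k} (f : Fin k → A) →
               Dec (Injective _≡_ _≡_ f)
  injective? _≟_ f =
    map′ (λ h {i} {j} → h i j) (λ h i j → h)
      (all? λ i → all? λ j → implies (f i ≟ f j) (i Fin.≟ j))
    where
    implies : ∀ {P Q : Set} → Dec P → Dec Q → Dec (P → Q)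
    implies _       (yes q) = yes λ _ → q
    implies (yes p) (no ¬q) = no λ h → ¬q (h p)
    implies (no ¬p) (no _)  = yes λ p → ⊥-elim (¬p p)

  _≟ᵥ_ : ∀ {m n} → DecidableEquality (ℤ[ m ]^ n)
  _≟ᵥ_ = ≡-dec Fin._≟_

  containsProperAP? : ∀ {m n s} k (S : Vec (ℤ[ m ]^ n) s) → Dec (ContainsProperAP k S)
  containsProperAP? {m} {n} k S =
    search-Vec any? n λ x → search-Vec any? n λ d →
      injective? _≟ᵥ_ (λ i → term x d (toℕ i))
      ×-dec all? (λ i → term x d (toℕ i) ∈? S)
    where open DecMembership (_≟ᵥ_ {m} {n}) using (_∈?_)

  hasAPFreeSetOfSize? : ∀ k m n → Decidable (HasAPFreeSetOfSize k m n)
  hasAPFreeSetOfSize? k m n s =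
    search-Vec (search-Vec any? n) s λ S →
      allPairs? (λ x y → ¬? (x ≟ᵥ y)) S ×-dec ¬? (containsProperAP? k S)

  index : ∀ {m n} → ℤ[ m ]^ n → Fin (m ℕ.^ n)
  index []       = zero
  index (x ∷ xs) = combine x (index xs)

  index-injective : ∀ {m n} → Injective _≡_ _≡_ (index {m} {n})
  index-injective {x = []}     {[]}     _ = refl
  index-injective {x = x ∷ xs} {y ∷ ys} e =
    let e₁ , e₂ = combine-injective x (index xs) y (index ys) e
    in cong₂ _∷_ e₁ (index-injective e₂)

  size-bounded : ∀ k m n s → HasAPFreeSetOfSize k m n s → s ℕ.≤ m ℕ.^ n
  size-bounded k m n s (S , uniq , _) =
    injective⇒≤ {f = λ i → index (lookup S i)}
      (λ {i} {j} e → lookup-injective uniq i j (index-injective e))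

  maximum : ∀ {P : ℕ → Set} → Decidable P → P 0 → ∀ b → (∀ s → P s → s ℕ.≤ b) →
            ∃ (IsMaximum P)
  maximum P? p₀ zero    bd = 0 , p₀ , bd
  maximum P? p₀ (suc b) bd with P? (suc b)
  ... | yes p = suc b , p , bd
  ... | no ¬p = maximum P? p₀ b λ s p →
    ℕ.≤-pred (ℕ.≤∧≢⇒< (bd s p) λ { refl → ¬p p })

  -- For k = 0 every set, even ∅, contains the empty progression.
  empty-free : ∀ k .{{_ : NonZero k}} m n → HasAPFreeSetOfSize k m n 0
  empty-free (suc k) m n = [] , [] , λ { (_ , _ , _ , all∈) → absurd (all∈ zero) }
    where
    absurd : ∀ {x : ℤ[ m ]^ n} → ¬ (x ∈ [])
    absurd ()

maxAPFree : ∀ k .{{_ : NonZero k}} m n → ∃ (IsMaximum (HasAPFreeSetOfSize k m n))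
maxAPFree k m n =
  maximum (hasAPFreeSetOfSize? k m n) (empty-free k m n) (m ℕ.^ n) (size-bounded k m n)

r : ∀ k .{{_ : NonZero k}} → ℕ → ℕ → ℕ
r k m n = proj₁ (maxAPFree k m n)

r₃≢0 : ∀ m n .{{_ : NonZero m}} → NonZero (r 3 m n)
r₃≢0 (suc m) n = ℕ.>-nonZero (proj₂ (proj₂ (maxAPFree 3 (suc m) n)) 1 singleton)
  where
  o : ℤ[ suc m ]^ n
  o = replicate n zero

  ∈-singleton : ∀ {x} → x ∈ o ∷ [] → x ≡ o
  ∈-singleton (here e) = e

  singleton : HasAPFreeSetOfSize 3 (suc m) n 1
  singleton = o ∷ [] , [] ∷ [] , λ where
    (x , d , inj , all∈) → contradiction
      (inj {zero} {suc zero}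
        (trans (∈-singleton (all∈ zero)) (sym (∈-singleton (all∈ (suc zero))))))
      λ ()

------------------------------------------------------------------------
-- Positive real numbers, as Dedekind cuts in the positive rationals

-- L q means q < x and U q means x < q, for positive rational q.  Only positive
-- reals occur below, so quantifying over ℝ⁺ includes the condition c > 0.
record ℝ⁺ : Set₁ where
  field
    L U     : ℚ → Set
    L-pos   : ∀ {q} → L q → 0ℚ < q
    L-inh   : ∃ L
    U-inh   : ∃ U
    L-down  : ∀ {p q} → 0ℚ < p → p < q → L q → L p
    L-open  : ∀ {p} → L p → ∃ λ q → p < q × L q
    U-up    : ∀ {p q} → p < q → U p → U q
    U-open  : ∀ {q} → U q → ∃ λ p → p < q × U p
    L<U     : ∀ {p q} → L p → U q → p < q
    located : ∀ {p q} → 0ℚ < p → p < q → L p ⊎ U q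

  U-pos : ∀ {q} → U q → 0ℚ < q
  U-pos u = ℚ.<-trans (L-pos (proj₂ L-inh)) (L<U (proj₂ L-inh) u)

open ℝ⁺

infix 4 _≤_
_≤_ : ℝ⁺ → ℝ⁺ → Set
x ≤ y = ∀ q → L x q → L y q

module CutLemmas where
  pos* : ∀ {p q} → 0ℚ < p → 0ℚ < q → 0ℚ < p ℚ.* q
  pos* {p} {q} a b = positive⁻¹ (p ℚ.* q) {{ℚ.pos*pos⇒pos p {{ℚ.positive a}} q {{ℚ.positive b}}}}

  pos+ : ∀ {p q} → 0ℚ < p → 0ℚ < q → 0ℚ < p + q
  pos+ a b = ℚ.+-mono-< a b

  0<½ : 0ℚ < ½
  0<½ = positive⁻¹ ½

  monoˡ : ∀ {p q r} → 0ℚ < r → p < q → p ℚ.* r < q ℚ.* r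
  monoˡ {r = r} c = ℚ.*-monoˡ-<-pos r {{ℚ.positive c}}

  monoʳ : ∀ {p q r} → 0ℚ < r → p < q → r ℚ.* p < r ℚ.* q
  monoʳ {r = r} c = ℚ.*-monoʳ-<-pos r {{ℚ.positive c}}

  mono* : ∀ {p q r s} → 0ℚ < p → 0ℚ < s → p < q → r < s → p ℚ.* r < q ℚ.* s
  mono* a b c d = ℚ.<-trans (monoʳ a d) (monoˡ b c)

  inv : ∀ {q} → 0ℚ < q → ∃ λ u → 0ℚ < u × q ℚ.* u ≡ 1ℚ
  inv {q} c =
    (1/ q) {{nz}} , positive⁻¹ _ {{1/pos⇒pos q {{ℚ.positive c}}}} , *-inverseʳ q {{nz}}
    where nz = pos⇒nonZero q {{ℚ.positive c}}

  inv-anti : ∀ {q u q′ u′} → 0ℚ < u → 0ℚ < u′ → q ℚ.* u ≡ 1ℚ → q′ ℚ.* u′ ≡ 1ℚ →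
             q < q′ → u′ < u
  inv-anti {q} {u} {q′} {u′} c c′ e e′ lt =
    subst₂′ lhs rhs (monoˡ (pos* c c′) lt)
    where
    open +-*-Solver
    subst₂′ : ∀ {a b a′ b′} → a ≡ a′ → b ≡ b′ → a < b → a′ < b′
    subst₂′ refl refl h = h
    lhs : q ℚ.* (u ℚ.* u′) ≡ u′
    lhs = trans (sym (ℚ.*-assoc q u u′)) (trans (cong (ℚ._* u′) e) (ℚ.*-identityˡ u′))
    rhs : q′ ℚ.* (u ℚ.* u′) ≡ u
    rhs = trans (solve 3 (λ a b c → a :* (b :* c) := (a :* c) :* b) refl q′ u u′)
            (trans (cong (ℚ._* u) e′) (ℚ.*-identityˡ u))

  inv-pos : ∀ {q u} → 0ℚ < q → q ℚ.* u ≡ 1ℚ → 0ℚ < u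
  inv-pos {q} {u} c e with inv c
  ... | v , v>0 , e′ = subst (0ℚ <_) v≡u v>0
    where
    v≡u : v ≡ u
    v≡u = trans (sym (ℚ.*-identityˡ v)) (trans (cong (ℚ._* v) (sym e))
      (trans (solve 3 (λ a b c → (a :* b) :* c := (a :* c) :* b) refl q u v)
        (trans (cong (ℚ._* u) e′) (ℚ.*-identityˡ u))))
      where open +-*-Solver

  -- (q + p/q)/2 is less than q, and its square exceeds p.
  √-below : ∀ {p q} → 0ℚ < p → 0ℚ < q → p < q ℚ.* q →
            ∃ λ h → 0ℚ < h × h < q × p < h ℚ.* h
  √-below {p} {q} p>0 q>0 lt with inv q>0
  ... | u , u>0 , e = h , h>0 , h<q , p<hh
    where
    open +-*-Solver
    h e₁ : ℚ
    h = ½ ℚ.* (q + p ℚ.* u)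
    e₁ = ½ ℚ.* (q - p ℚ.* u)
    h>0 : 0ℚ < h
    h>0 = pos* 0<½ (pos+ q>0 (pos* p>0 u>0))
    pu<q : p ℚ.* u < q
    pu<q = subst (p ℚ.* u <_)
      (trans (ℚ.*-assoc q q u) (trans (cong (q ℚ.*_) e) (ℚ.*-identityʳ q))) (monoˡ u>0 lt)
    h<q : h < q
    h<q = subst (h <_) (solve 1 (λ q → con ½ :* (q :+ q) := q) refl q)
            (monoʳ 0<½ (ℚ.+-monoʳ-< q pu<q))
    e₁>0 : 0ℚ < e₁
    e₁>0 = pos* 0<½ (subst (_< q - p ℚ.* u) (ℚ.+-inverseʳ (p ℚ.* u))
             (ℚ.+-monoˡ-< (ℚ.- (p ℚ.* u)) pu<q))
    p<hh : p < h ℚ.* h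
    p<hh = subst (p <_)
      (trans
        (cong (_+ e₁ ℚ.* e₁)
          (sym (trans (solve 3 (λ p q u → q :* (p :* u) := p :* (q :* u)) refl p q u)
            (trans (cong (p ℚ.*_) e) (ℚ.*-identityʳ p)))))
        (solve 2 (λ q v → q :* v :+ (con ½ :* (q :- v)) :* (con ½ :* (q :- v))
                        := (con ½ :* (q :+ v)) :* (con ½ :* (q :+ v))) refl q (p ℚ.* u)))
      (subst (_< p + e₁ ℚ.* e₁) (ℚ.+-identityʳ p) (ℚ.+-monoʳ-< p (pos* e₁>0 e₁>0)))

  square-inv : ∀ {a b} → a ℚ.* b ≡ 1ℚ → (a ℚ.* a) ℚ.* (b ℚ.* b) ≡ 1ℚ
  square-inv {a} {b} e =
    trans (solve 2 (λ a b → (a :* a) :* (b :* b) := (a :* b) :* (a :* b)) refl a b)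
      (cong₂ ℚ._*_ e e)
    where open +-*-Solver

  √-above : ∀ {q s} → 0ℚ < q → 0ℚ < s → q ℚ.* q < s →
            ∃ λ h → q < h × h ℚ.* h < s
  √-above {q} {s} q>0 s>0 lt =
    let u , u>0 , eu    = inv q>0
        v , v>0 , ev    = inv s>0
        g , g>0 , g<u , v<gg =
          √-below v>0 u>0 (inv-anti (pos* u>0 u>0) v>0 (square-inv {q} eu) ev lt)
        h , h>0 , eh    = inv g>0
    in h
     , inv-anti h>0 q>0 eh (trans (ℚ.*-comm u q) eu) g<u
     , inv-anti s>0 (pos* h>0 h>0) (trans (ℚ.*-comm v s) ev) (square-inv {g} eh) v<gg

  steps : ℕ → ℚ
  steps zero    = 0ℚ
  steps (suc k) = 1ℚ + steps k

  archimedean : ∀ p → ∃ λ k → p ℚ.≤ steps k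
  archimedean p@record{} = ℤ.∣ ↥ p ∣ , ℚ.toℚᵘ-cancel-≤
    (ℚᵘ.≤-trans p≤∣↥p∣ (ℚᵘ.≤-reflexive (ℚᵘ.≃-sym (steps≃ ℤ.∣ ↥ p ∣))))
    where
    steps≃ : ∀ k → ℚ.toℚᵘ (steps k) ℚᵘ.≃ ℚᵘ.mkℚᵘ (+ k) 0
    steps≃ zero    = ℚᵘ.≃-refl
    steps≃ (suc k) = ℚᵘ.≃-trans (ℚ.toℚᵘ-homo-+ 1ℚ (steps k))
      (ℚᵘ.≃-trans (ℚᵘ.+-congʳ (ℚᵘ.mkℚᵘ (+ 1) 0) (steps≃ k))
        (ℚᵘ.*≡* (cong (λ z → (+ 1 ℤ.+ z) ℤ.* + 1) (ℤ.*-identityʳ (+ k)))))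

    +∣_∣ : ∀ i → i ℤ.≤ + ℤ.∣ i ∣
    +∣ + n       ∣ = ℤ.≤-refl
    +∣ ℤ.-[1+ n ] ∣ = ℤ.-≤+

    p≤∣↥p∣ : ℚ.toℚᵘ p ℚᵘ.≤ ℚᵘ.mkℚᵘ (+ ℤ.∣ ↥ p ∣) 0
    p≤∣↥p∣ = ℚᵘ.*≤* (ℤ.≤-trans
      (ℤ.≤-reflexive (ℤ.*-identityʳ (↥ p)))
      (ℤ.≤-trans +∣ ↥ p ∣
        (ℤ.≤-trans (ℤ.+≤+ (ℕ.m≤m*n ℤ.∣ ↥ p ∣ (ℚ.↧ₙ p)))
          (ℤ.≤-reflexive (ℤ.pos-* ℤ.∣ ↥ p ∣ (ℚ.↧ₙ p))))))

  -- A cut has a lower and an upper element whose ratio exceeds any h < 1.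
  narrow : ∀ x {h} → 0ℚ < h → h < 1ℚ → ∃₂ λ a b → L x a × U x b × a ≡ h ℚ.* b
  narrow x {h} h>0 h<1 with ℚ.<-dense h<1
  ... | s , h<s , s<1 = start
    where
    open +-*-Solver
    a₀ b₀ δ : ℚ
    a₀ = proj₁ (L-inh x)
    b₀ = proj₁ (U-inh x)
    a₀∈L = proj₂ (L-inh x)
    b₀∈U = proj₂ (U-inh x)
    δ = (1ℚ - s) ℚ.* a₀
    1-s>0 : 0ℚ < 1ℚ - s
    1-s>0 = subst (_< 1ℚ - s) (ℚ.+-inverseʳ s) (ℚ.+-monoˡ-< (ℚ.- s) s<1)
    δ>0 : 0ℚ < δ
    δ>0 = pos* 1-s>0 (L-pos x a₀∈L)

    search : ∀ k {b} → b ℚ.≤ a₀ + steps k ℚ.* δ → U x b →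
             ∃₂ λ a b → L x a × U x b × a ≡ h ℚ.* b
    search zero {b} le b∈U = contradiction (ℚ.<-≤-trans (L<U x a₀∈L b∈U)
      (ℚ.≤-trans le (ℚ.≤-reflexive
        (solve 2 (λ a d → a :+ con 0ℚ :* d := a) refl a₀ δ)))) (ℚ.<-irrefl refl)
    search (suc k) {b} le b∈U
      with located x (pos* h>0 (U-pos x b∈U)) (monoˡ (U-pos x b∈U) h<s)
    ... | inj₁ hb∈L = h ℚ.* b , b , hb∈L , b∈U , refl
    ... | inj₂ sb∈U = search k (ℚ.<⇒≤ sb<) sb∈U
      where
      sb< : s ℚ.* b < a₀ + steps k ℚ.* δ
      sb< = subst (_< a₀ + steps k ℚ.* δ)
        (solve 2 (λ s b → b :- (con 1ℚ :- s) :* b := s :* b) refl s b)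
        (subst (b - (1ℚ - s) ℚ.* b <_)
          (solve 3 (λ a t d → (a :+ (con 1ℚ :+ t) :* d) :- d := a :+ t :* d) refl a₀ (steps k) δ)
          (ℚ.+-mono-≤-< le (ℚ.neg-antimono-< (monoʳ 1-s>0 (L<U x a₀∈L b∈U)))))

    start : ∃₂ λ a b → L x a × U x b × a ≡ h ℚ.* b
    start =
      let u , _ , e = inv δ>0
          k , le    = archimedean (b₀ ℚ.* u)
      in search k (ℚ.≤-trans (b₀≤ {k} {u} e le) (ℚ.<⇒≤ (kδ< k))) b₀∈U
      where
      b₀≤ : ∀ {k u} → δ ℚ.* u ≡ 1ℚ → b₀ ℚ.* u ℚ.≤ steps k → b₀ ℚ.≤ steps k ℚ.* δ
      b₀≤ {k} {u} e le = subst (ℚ._≤ steps k ℚ.* δ)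
        (trans (solve 3 (λ b u d → (b :* u) :* d := b :* (d :* u)) refl b₀ u δ)
          (trans (cong (b₀ ℚ.*_) e) (ℚ.*-identityʳ b₀)))
        (ℚ.*-monoʳ-≤-nonNeg δ {{ℚ.pos⇒nonNeg δ {{ℚ.positive δ>0}}}} le)
      kδ< : ∀ k → steps k ℚ.* δ < a₀ + steps k ℚ.* δ
      kδ< k = subst (_< a₀ + steps k ℚ.* δ) (ℚ.+-identityˡ _)
        (ℚ.+-monoˡ-< (steps k ℚ.* δ) (L-pos x a₀∈L))

open CutLemmas

fromℚ : (q : ℚ) .{{_ : Positive q}} → ℝ⁺
fromℚ q = record
  { L       = λ p → 0ℚ < p × p < q
  ; U       = λ p → q < p
  ; L-pos   = proj₁
  ; L-inh   = let p , 0<p , p<q = ℚ.<-dense (positive⁻¹ q) in p , 0<p , p<q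
  ; U-inh   = q + 1ℚ , subst (_< q + 1ℚ) (ℚ.+-identityʳ q) (ℚ.+-monoʳ-< q (positive⁻¹ 1ℚ))
  ; L-down  = λ 0<p p<p′ (_ , p′<q) → 0<p , ℚ.<-trans p<p′ p′<q
  ; L-open  = λ (0<p , p<q) → let p′ , p<p′ , p′<q = ℚ.<-dense p<q
                              in p′ , p<p′ , ℚ.<-trans 0<p p<p′ , p′<q
  ; U-up    = λ p<p′ q<p → ℚ.<-trans q<p p<p′
  ; U-open  = λ q<p → let p′ , q<p′ , p′<p = ℚ.<-dense q<p in p′ , p′<p , q<p′
  ; L<U     = λ (_ , p<q) q<p′ → ℚ.<-trans p<q q<p′
  ; located = loc
  }
  where
  loc : ∀ {p p′} → 0ℚ < p → p < p′ → (0ℚ < p × p < q) ⊎ q < p′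
  loc {p} 0<p p<p′ with p ℚ.<? q
  ... | yes p<q = inj₁ (0<p , p<q)
  ... | no  p≮q = inj₂ (ℚ.≤-<-trans (ℚ.≮⇒≥ p≮q) p<p′)

fromℕ : (n : ℕ) .{{_ : NonZero n}} → ℝ⁺
fromℕ n = fromℚ (+ n ℚ./ 1) {{ℚ.normalize-pos n 1}}

infixl 7 _*_ _÷_
_*_ : ℝ⁺ → ℝ⁺ → ℝ⁺
x * y = record
  { L       = λ q → 0ℚ < q × ∃₂ λ a b → L x a × L y b × q < a ℚ.* b
  ; U       = λ q → ∃₂ λ a b → U x a × U y b × a ℚ.* b < q
  ; L-pos   = proj₁
  ; L-inh   = let a , a∈ = L-inh x
                  b , b∈ = L-inh y
                  q , 0<q , q<ab = ℚ.<-dense (pos* (L-pos x a∈) (L-pos y b∈))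
              in q , 0<q , a , b , a∈ , b∈ , q<ab
  ; U-inh   = let a , a∈ = U-inh x
                  b , b∈ = U-inh y
              in a ℚ.* b + 1ℚ , a , b , a∈ , b∈
               , subst (_< a ℚ.* b + 1ℚ) (ℚ.+-identityʳ _) (ℚ.+-monoʳ-< (a ℚ.* b) (positive⁻¹ 1ℚ))
  ; L-down  = λ 0<p p<q (_ , a , b , a∈ , b∈ , q<ab) →
                0<p , a , b , a∈ , b∈ , ℚ.<-trans p<q q<ab
  ; L-open  = λ (0<p , a , b , a∈ , b∈ , p<ab) →
                let q , p<q , q<ab = ℚ.<-dense p<ab
                in q , p<q , ℚ.<-trans 0<p p<q , a , b , a∈ , b∈ , q<ab
  ; U-up    = λ p<q (a , b , a∈ , b∈ , ab<p) → a , b , a∈ , b∈ , ℚ.<-trans ab<p p<q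
  ; U-open  = λ (a , b , a∈ , b∈ , ab<q) →
                let p , ab<p , p<q = ℚ.<-dense ab<q in p , p<q , a , b , a∈ , b∈ , ab<p
  ; L<U     = λ (_ , a , b , a∈ , b∈ , p<ab) (c , d , c∈ , d∈ , cd<q) →
                ℚ.<-trans p<ab (ℚ.<-trans
                  (mono* (L-pos x a∈) (U-pos y d∈) (L<U x a∈ c∈) (L<U y b∈ d∈)) cd<q)
  ; located = loc
  }
  where
  open +-*-Solver
  Lower Upper : ℚ → Set
  Lower p = 0ℚ < p × ∃₂ λ a b → L x a × L y b × p < a ℚ.* b
  Upper q = ∃₂ λ a b → U x a × U y b × a ℚ.* b < q

  shrink : ∀ {p q} → 0ℚ < p → p < q → ∃ λ h → 0ℚ < h × h < 1ℚ × p < (h ℚ.* h) ℚ.* q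
  shrink {p} {q} 0<p p<q =
    let u , u>0 , e = inv 0<q
        h , h>0 , h<1 , pu<hh =
          √-below (pos* 0<p u>0) (positive⁻¹ 1ℚ) (subst (p ℚ.* u <_) e (monoˡ u>0 p<q))
    in h , h>0 , h<1
     , subst (_< (h ℚ.* h) ℚ.* q)
         (trans (solve 3 (λ p u q → (p :* u) :* q := p :* (q :* u)) refl p u q)
           (trans (cong (p ℚ.*_) e) (ℚ.*-identityʳ p)))
         (monoˡ 0<q pu<hh)
    where 0<q = ℚ.<-trans 0<p p<q

  compare : ∀ {p q h} → 0ℚ < p → 0ℚ < h → p < (h ℚ.* h) ℚ.* q →
            (∃₂ λ a b → L x a × U x b × a ≡ h ℚ.* b) →
            (∃₂ λ c d → L y c × U y d × c ≡ h ℚ.* d) →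
            Lower p ⊎ Upper q
  compare {p} {q} {h} 0<p h>0 p<hhq (_ , b , a∈ , b∈ , refl) (_ , d , c∈ , d∈ , refl)
    with b ℚ.* d ℚ.<? q
  ... | yes bd<q = inj₂ (b , d , b∈ , d∈ , bd<q)
  ... | no  bd≮q = inj₁ (0<p , h ℚ.* b , h ℚ.* d , a∈ , c∈ , ℚ.<-≤-trans p<hhq hhq≤)
    where
    hhq≤ : (h ℚ.* h) ℚ.* q ℚ.≤ (h ℚ.* b) ℚ.* (h ℚ.* d)
    hhq≤ = subst ((h ℚ.* h) ℚ.* q ℚ.≤_)
      (solve 3 (λ h b d → (h :* h) :* (b :* d) := (h :* b) :* (h :* d)) refl h b d)
      (ℚ.*-monoˡ-≤-nonNeg (h ℚ.* h)
        {{ℚ.pos⇒nonNeg (h ℚ.* h) {{ℚ.positive (pos* h>0 h>0)}}}} (ℚ.≮⇒≥ bd≮q))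

  loc : ∀ {p q} → 0ℚ < p → p < q → Lower p ⊎ Upper q
  loc 0<p p<q =
    let h , h>0 , h<1 , p<hhq = shrink 0<p p<q
    in compare 0<p h>0 p<hhq (narrow x h>0 h<1) (narrow y h>0 h<1)

infix 8 _⁻¹
_⁻¹ : ℝ⁺ → ℝ⁺
x ⁻¹ = record
  { L       = λ q → ∃ λ u → q ℚ.* u ≡ 1ℚ × U x u
  ; U       = λ q → ∃ λ u → q ℚ.* u ≡ 1ℚ × L x u
  ; L-pos   = λ {q} (u , e , u∈) → flip-pos q u (U-pos x u∈) e
  ; L-inh   = let u , u∈ = U-inh x
                  q , _ , e = inv (U-pos x u∈)
              in q , u , flip {u} e , u∈
  ; U-inh   = let u , u∈ = L-inh x
                  q , _ , e = inv (L-pos x u∈)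
              in q , u , flip {u} e , u∈
  ; L-down  = λ {p} 0<p p<q (u , e , u∈) →
                let v , 0<v , e′ = inv 0<p
                in v , e′ , U-up x (inv-anti 0<v (U-pos x u∈) e′ e p<q) u∈
  ; L-open  = λ {p} (u , e , u∈) →
                let v , v<u , v∈ = U-open x u∈
                    q , 0<q , e′ = inv (U-pos x v∈)
                in q , inv-anti 0<q (flip-pos p u (U-pos x u∈) e) e′ (flip {p} e) v<u
                 , v , flip {v} e′ , v∈
  ; U-up    = λ {p} p<q (u , e , u∈) →
                let 0<u = L-pos x u∈
                    v , 0<v , e′ = inv (ℚ.<-trans (flip-pos p u 0<u e) p<q)
                in v , e′ , L-down x 0<v (inv-anti 0<u 0<v e e′ p<q) u∈
  ; U-open  = λ {p} (u , e , u∈) →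
                let v , u<v , v∈ = L-open x u∈
                    q , 0<q , e′ = inv (L-pos x v∈)
                in q , inv-anti (flip-pos p u (L-pos x u∈) e) 0<q (flip {p} e) e′ u<v
                 , v , flip {v} e′ , v∈
  ; L<U     = λ {p} {q} (u , e , u∈) (v , e′ , v∈) →
                inv-anti (flip-pos q v (L-pos x v∈) e′) (flip-pos p u (U-pos x u∈) e)
                  (flip {q} e′) (flip {p} e) (L<U x v∈ u∈)
  ; located = loc
  }
  where
  flip : ∀ {q u} → q ℚ.* u ≡ 1ℚ → u ℚ.* q ≡ 1ℚ
  flip {q} {u} = trans (ℚ.*-comm u q)

  flip-pos : ∀ q u → 0ℚ < u → q ℚ.* u ≡ 1ℚ → 0ℚ < q
  flip-pos q u 0<u e = inv-pos 0<u (flip {q} e)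

  loc : ∀ {p q} → 0ℚ < p → p < q →
        (∃ λ u → p ℚ.* u ≡ 1ℚ × U x u) ⊎ (∃ λ u → q ℚ.* u ≡ 1ℚ × L x u)
  loc 0<p p<q =
    let u , 0<u , e  = inv 0<p
        v , 0<v , e′ = inv (ℚ.<-trans 0<p p<q)
    in swap (Sum.map (λ v∈ → v , e′ , v∈) (λ u∈ → u , e , u∈)
         (located x 0<v (inv-anti 0<u 0<v e e′ p<q)))

_÷_ : ℝ⁺ → ℝ⁺ → ℝ⁺
x ÷ y = x * y ⁻¹

infix 9 √_
√_ : ℝ⁺ → ℝ⁺
√ x = record
  { L       = λ q → 0ℚ < q × L x (q ℚ.* q)
  ; U       = λ q → 0ℚ < q × U x (q ℚ.* q)
  ; L-pos   = proj₁
  ; L-inh   = l-inh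
  ; U-inh   = u-inh
  ; L-down  = λ 0<p p<q (0<q , q∈) → 0<p , L-down x (pos* 0<p 0<p) (mono* 0<p 0<q p<q p<q) q∈
  ; L-open  = λ (0<p , p∈) →
                let s , pp<s , s∈ = L-open x p∈
                    h , p<h , hh<s = √-above 0<p (L-pos x s∈) pp<s
                    0<h = ℚ.<-trans 0<p p<h
                in h , p<h , 0<h , L-down x (pos* 0<h 0<h) hh<s s∈
  ; U-up    = λ p<q (0<p , p∈) → ℚ.<-trans 0<p p<q
                , U-up x (mono* 0<p (ℚ.<-trans 0<p p<q) p<q p<q) p∈
  ; U-open  = λ (0<q , q∈) →
                let s , s<qq , s∈ = U-open x q∈
                    h , 0<h , h<q , s<hh = √-below (U-pos x s∈) 0<q s<qq
                in h , h<q , 0<h , U-up x s<hh s∈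
  ; L<U     = λ (0<p , p∈) (0<q , q∈) → cancel 0<p 0<q (L<U x p∈ q∈)
  ; located = loc
  }
  where
  cancel : ∀ {p q} → 0ℚ < p → 0ℚ < q → p ℚ.* p < q ℚ.* q → p < q
  cancel {p} {q} 0<p 0<q lt with p ℚ.<? q
  ... | yes p<q = p<q
  ... | no  p≮q = contradiction (ℚ.<-≤-trans lt
    (ℚ.≤-trans (ℚ.*-monoˡ-≤-nonNeg q {{ℚ.pos⇒nonNeg q {{ℚ.positive 0<q}}}} (ℚ.≮⇒≥ p≮q))
      (ℚ.*-monoʳ-≤-nonNeg p {{ℚ.pos⇒nonNeg p {{ℚ.positive 0<p}}}} (ℚ.≮⇒≥ p≮q))))
    (ℚ.<-irrefl refl)

  loc : ∀ {p q} → 0ℚ < p → p < q →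
        (0ℚ < p × L x (p ℚ.* p)) ⊎ (0ℚ < q × U x (q ℚ.* q))
  loc 0<p p<q = Sum.map (0<p ,_) (0<q ,_)
    (located x (pos* 0<p 0<p) (mono* 0<p 0<q p<q p<q))
    where 0<q = ℚ.<-trans 0<p p<q

  u-inh : ∃ λ q → 0ℚ < q × U x (q ℚ.* q)
  u-inh = let u , u∈ = U-inh x
              0<u = U-pos x u∈
              0<1+u = pos+ (positive⁻¹ 1ℚ) 0<u
              u<1+u = subst (_< 1ℚ + u) (ℚ.+-identityˡ u) (ℚ.+-monoˡ-< u (positive⁻¹ 1ℚ))
              1<1+u = subst (_< 1ℚ + u) (ℚ.+-identityʳ 1ℚ) (ℚ.+-monoʳ-< 1ℚ 0<u)
          in 1ℚ + u , 0<1+u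
           , U-up x (subst (_< (1ℚ + u) ℚ.* (1ℚ + u)) (ℚ.*-identityˡ u)
                      (mono* (positive⁻¹ 1ℚ) 0<1+u 1<1+u u<1+u)) u∈

  l-inh : ∃ λ q → 0ℚ < q × L x (q ℚ.* q)
  l-inh = let l , l∈ = L-inh x
              0<l = L-pos x l∈
              u , 0<u , e = inv 0<l
              0<1+u = pos+ (positive⁻¹ 1ℚ) 0<u
              u<1+u = subst (_< 1ℚ + u) (ℚ.+-identityˡ u) (ℚ.+-monoˡ-< u (positive⁻¹ 1ℚ))
              1<1+u = subst (_< 1ℚ + u) (ℚ.+-identityʳ 1ℚ) (ℚ.+-monoʳ-< 1ℚ 0<u)
              v , 0<v , e′ = inv 0<1+u
              u<sq = subst (_< (1ℚ + u) ℚ.* (1ℚ + u)) (ℚ.*-identityˡ u)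
                       (mono* (positive⁻¹ 1ℚ) 0<1+u 1<1+u u<1+u)
          in v , 0<v
           , L-down x (pos* 0<v 0<v)
               (inv-anti 0<l (pos* 0<v 0<v) (trans (ℚ.*-comm u l) e) (square-inv {1ℚ + u} e′) u<sq)
               l∈

infixr 8 _^_
_^_ : ℝ⁺ → ℕ → ℝ⁺
x ^ zero  = fromℕ 1
x ^ suc n = x * x ^ n

-- |x - 1| < ε.  The lower bound 1 - ε < x is automatic when 1 - ε ≤ 0.
∣_-1∣<_ : ℝ⁺ → ℚ → Set
∣ x -1∣< ε = (0ℚ < 1ℚ - ε → L x (1ℚ - ε)) × U x (1ℚ + ε)

------------------------------------------------------------------------
-- The constants

-- The truncated subtraction is exact for m ≥ 4.
2880σ² : ℕ → ℕ
2880σ² m = (m ℕ.^ 4 ℕ.+ 8 ℕ.* m ℕ.^ 3 ℕ.+ 4 ℕ.* m ℕ.^ 2) ℕ.∸ 48 ℕ.* m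

2880σ²≢0 : ∀ m → 4 ℕ.≤ m → NonZero (2880σ² m)
2880σ²≢0 m m≥4 = ℕ.>-nonZero (ℕ.m<n⇒0<n∸m (begin-strict
  48 ℕ.* m                                         <⟨ ℕ.*-monoˡ-< m {{m≢0}} (ℕ.m≤m+n 49 15) ⟩
  64 ℕ.* m                                         ≤⟨ ℕ.*-monoˡ-≤ m (ℕ.^-monoˡ-≤ 3 m≥4) ⟩
  m ℕ.^ 3 ℕ.* m                                    ≡⟨ ℕ.*-comm (m ℕ.^ 3) m ⟩
  m ℕ.^ 4                                          ≤⟨ ℕ.m≤m+n _ _ ⟩
  m ℕ.^ 4 ℕ.+ 8 ℕ.* m ℕ.^ 3                        ≤⟨ ℕ.m≤m+n _ _ ⟩
  m ℕ.^ 4 ℕ.+ 8 ℕ.* m ℕ.^ 3 ℕ.+ 4 ℕ.* m ℕ.^ 2      ∎))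
  where
  open ℕ.≤-Reasoning
  m≢0 = ℕ.>-nonZero (ℕ.≤-trans (s≤s z≤n) m≥4)

σ : ∀ m → .(4 ℕ.≤ m) → ℝ⁺
σ m m≥4 = √ (fromℕ (2880σ² m) {{2880σ²≢0 m m≥4}} ÷ fromℕ 2880)

C : ∀ m → .(4 ℕ.≤ m) → ℝ⁺
C m m≥4 = fromℕ 1 ÷ (fromℕ 3 * √ fromℕ 3 * σ m m≥4)

4≤⇒≢0 : ∀ {m} → 4 ℕ.≤ m → NonZero m
4≤⇒≢0 (s≤s _) = _

C-asymptotic : ∀ m → .(4 ℕ.≤ m) → ℝ⁺
C-asymptotic m m≥4 = fromℕ 8 * √ fromℕ 5 ÷ (√ fromℕ 3 * fromℕ m {{4≤⇒≢0 m≥4}} ^ 2)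

LowerBound : ∀ m → .(4 ℕ.≤ m) → ℝ⁺ → ∀ n .{{_ : NonZero n}} → Set
LowerBound m m≥4 c n =
  c ÷ √ fromℕ n * (fromℕ (2 ℕ.+ m) ÷ fromℕ 2) ^ n
    ≤ fromℕ (r 3 m n) {{r₃≢0 m n {{4≤⇒≢0 m≥4}}}}

{-# OPTIONS --safe #-}
module Submission where

open import Defs renaming (_≤_ to _≤ᴿ_; _*_ to _*ᴿ_; _^_ to _^ᴿ_)
open import Data.Bool.Base using (if_then_else_)
open import Data.Fin.Base using (Fin; zero; suc; toℕ; inject≤)
open import Data.Fin.Properties
  using (toℕ<n; toℕ-injective; toℕ-fromℕ<; toℕ-inject≤; inject≤-injective)
import Data.Integer.Base as ℤ
import Data.Integer.Properties as ℤ
open import Data.List.Base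
  using (List; []; _∷_; _++_; map; length; filter; tabulate; applyUpTo; downFrom; cartesianProductWith)
open import Data.List.Membership.Propositional using () renaming (_∈_ to _∈ˡ_)
open import Data.List.Membership.Propositional.Properties
  using (∈-downFrom⁺; ∈-tabulate⁻; ∈-cartesianProductWith⁻; ∈-filter⁻)
open import Data.List.Properties using (length-++; length-map; length-tabulate; length-downFrom)
open import Data.List.Relation.Unary.All using ([]; _∷_)
open import Data.List.Relation.Unary.AllPairs using ([]; _∷_)
open import Data.List.Relation.Unary.Any using (here; there)
open import Data.List.Relation.Unary.Unique.Propositional using () renaming (Unique to Uniqueˡ)
import Data.List.Relation.Unary.Unique.Propositional.Properties as Uniqueˡ
open import Data.Nat.Base as ℕ
  using (ℕ; zero; suc; NonZero; z≤n; s≤s; _+_; _*_; _^_; _∸_; _≤_; _<_; ∣_-_∣; _/_; _%_)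
open import Data.Nat.Divisibility using (_∣_; divides)
open import Data.Nat.DivMod using (m≡m%n+[m/n]*n; m%n<n)
open import Data.Nat.ListAction using (sum)
open import Data.Nat.Properties
open import Data.Nat.Tactic.RingSolver using (solve-∀)
open import Data.Product.Base using (∃-syntax; _×_; _,_; proj₁; proj₂)
open import Data.Rational.Base as ℚ using (ℚ; 0ℚ; 1ℚ)
import Data.Rational.Properties as ℚ
open import Data.Rational.Solver using (module +-*-Solver)
import Data.Rational.Unnormalised.Base as ℚᵘ
import Data.Rational.Unnormalised.Properties as ℚᵘ
open import Data.Sum.Base using (inj₁; inj₂; fromInj₁; fromInj₂)
open import Data.Vec.Base using (Vec; []; _∷_; fromList)
open import Data.Vec.Membership.Propositional.Properties using (∈-fromList⁻)
open import Data.Vec.Properties using (∷-injective)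
open import Data.Vec.Relation.Unary.All using (All; []; _∷_)
import Data.Vec.Relation.Unary.All.Properties as All
open import Data.Vec.Relation.Unary.AllPairs using ([]; _∷_)
open import Data.Vec.Relation.Unary.Unique.Propositional using (Unique)
open import Function.Base using (_∘_; it)
open import Relation.Binary.PropositionalEquality
open import Relation.Nullary using (¬_; Dec; yes; no; contradiction)
open import Relation.Nullary.Decidable using (dec-true; does)
open import Relation.Unary using (Decidable)

open ≤-Reasoning

-- Write h = m / 2 and let Q(x) = Σ xᵢ (h − xᵢ) on {0, …, h}ⁿ.  The parallelogram law, which
-- survives reduction modulo 2h on these digits, shows that a progression x, y, z inside a
-- level set of Q has x = z, so every level set has at most M = r₃ elements.  But Q is integral
-- with variance nσ², and an integer-valued statistic on N points with fibres of size at most M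
-- has mean square distance at least (N² / M² − 1) / 12 to any of its values.  Averaging over
-- the values gives 2nσ² ≥ (N² / M² − 1) / 12, that is N² ≤ (24 nσ² + 1) M² ≤ 27 nσ² M² for
-- N = (h + 1)ⁿ; the one exception to 3nσ² ≥ 1 is m = 4, n = 1.  (With Chebyshev's inequality
-- the number of integers in an interval exceeds its length by up to 1, which is too lossy.)

-- The number (L² - 1) / 12 is the variance of the uniform distribution on L consecutive integers.
-- With fibres of size at most M, the most concentrated statistic fills about L = N / M of them, so
-- the dispersion bound has its natural shape even when N / M is not an integer. Its centre is taken
-- to be an integer, so that exactly 2k + 1 integers lie within distance k of it, whereas the mean
-- of Q may be fractional. Using the values of Q as centres eliminates the mean at the price of a
-- factor 2, which the constant 27 absorbs. Keeping both end digits 0 and h makes N the exact power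
-- ((m + 2) / 2)ⁿ, at the price of wrap-around triples such as (0, h, 0), where x = z but y differs.
-- There d has order two and the progression is not proper, so x = z is all that has to be shown.
-- Identities are stated in ℕ with negative terms moved across, and real numbers enter only through
-- their squares, which are rational.

private variable
  A B D : Set

-- Finite sums over lists and indicator functions

∑ : List A → (A → ℕ) → ℕ
∑ xs f = sum (map f xs)

∑-cong : ∀ (xs : List A) {f g : A → ℕ} → (∀ x → f x ≡ g x) → ∑ xs f ≡ ∑ xs g
∑-cong []       f≡g = refl
∑-cong (x ∷ xs) f≡g = cong₂ _+_ (f≡g x) (∑-cong xs f≡g)

∑-mono : ∀ (xs : List A) {f g : A → ℕ} → (∀ x → f x ≤ g x) → ∑ xs f ≤ ∑ xs g
∑-mono []       f≤g = z≤n
∑-mono (x ∷ xs) f≤g = +-mono-≤ (f≤g x) (∑-mono xs f≤g)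

∑-+ : ∀ (xs : List A) (f g : A → ℕ) → ∑ xs (λ x → f x + g x) ≡ ∑ xs f + ∑ xs g
∑-+ []       f g = refl
∑-+ (x ∷ xs) f g rewrite ∑-+ xs f g = interchange (f x) (g x) (∑ xs f) (∑ xs g)
  where
  interchange : ∀ a b c d → a + b + (c + d) ≡ a + c + (b + d)
  interchange = solve-∀

∑-*ˡ : ∀ (xs : List A) k (f : A → ℕ) → ∑ xs (λ x → k * f x) ≡ k * ∑ xs f
∑-*ˡ []       k f = sym (*-zeroʳ k)
∑-*ˡ (x ∷ xs) k f rewrite ∑-*ˡ xs k f = sym (*-distribˡ-+ k (f x) (∑ xs f))

∑-*ʳ : ∀ (xs : List A) k (f : A → ℕ) → ∑ xs (λ x → f x * k) ≡ ∑ xs f * k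
∑-*ʳ []       k f = refl
∑-*ʳ (x ∷ xs) k f rewrite ∑-*ʳ xs k f = sym (*-distribʳ-+ k (f x) (∑ xs f))

∑-const : ∀ (xs : List A) k → ∑ xs (λ _ → k) ≡ length xs * k
∑-const []       k = refl
∑-const (x ∷ xs) k = cong (k +_) (∑-const xs k)

∑-swap : ∀ (xs : List A) (ys : List B) (f : A → B → ℕ) →
         ∑ xs (λ x → ∑ ys (f x)) ≡ ∑ ys (λ y → ∑ xs (λ x → f x y))
∑-swap []       ys f = sym (trans (∑-const ys 0) (*-zeroʳ (length ys)))
∑-swap (x ∷ xs) ys f rewrite ∑-swap xs ys f =
  sym (∑-+ ys (f x) (λ y → ∑ xs (λ x → f x y)))

∑-∈ : ∀ {xs : List A} {x} (f : A → ℕ) → x ∈ˡ xs → f x ≤ ∑ xs f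
∑-∈ f (here refl)       = m≤m+n _ _
∑-∈ f (there {x = y} p) = ≤-trans (∑-∈ f p) (m≤n+m _ (f y))

∑-++ : ∀ (xs ys : List A) (f : A → ℕ) → ∑ (xs ++ ys) f ≡ ∑ xs f + ∑ ys f
∑-++ []       ys f = refl
∑-++ (x ∷ xs) ys f = trans (cong (f x +_) (∑-++ xs ys f)) (sym (+-assoc (f x) _ _))

∑-map : ∀ (g : A → B) (xs : List A) (f : B → ℕ) → ∑ (map g xs) f ≡ ∑ xs (f ∘ g)
∑-map g []       f = refl
∑-map g (x ∷ xs) f = cong (f (g x) +_) (∑-map g xs f)

∑-cartesianProductWith : ∀ (g : A → B → D) xs ys (f : D → ℕ) →
  ∑ (cartesianProductWith g xs ys) f ≡ ∑ xs (λ x → ∑ ys (λ y → f (g x y)))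
∑-cartesianProductWith g []       ys f = refl
∑-cartesianProductWith g (x ∷ xs) ys f =
  trans (∑-++ (map (g x) ys) _ f)
    (cong₂ _+_ (∑-map (g x) ys f) (∑-cartesianProductWith g xs ys f))

∑-tabulate : ∀ {n} (g : Fin n → A) (f : A → ℕ) (F : ℕ → ℕ) →
  (∀ i → f (g i) ≡ F (toℕ i)) → ∑ (tabulate g) f ≡ sum (applyUpTo F n)
∑-tabulate {n = zero}  g f F eq = refl
∑-tabulate {n = suc n} g f F eq =
  cong₂ _+_ (eq zero) (∑-tabulate (g ∘ suc) f (F ∘ suc) (eq ∘ suc))

𝟙 : ∀ {P : Set} → Dec P → ℕ
𝟙 P? = if does P? then 1 else 0

𝟙-true : ∀ {P : Set} (P? : Dec P) → P → 𝟙 P? ≡ 1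
𝟙-true P? p rewrite dec-true P? p = refl

𝟙-≤ : ∀ {P : Set} {m} (P? : Dec P) → (P → 1 ≤ m) → 𝟙 P? ≤ m
𝟙-≤ (yes p) 1≤m = 1≤m p
𝟙-≤ (no _)  _   = z≤n

length-filter≡∑𝟙 : ∀ {P : A → Set} (P? : Decidable P) xs →
  length (filter P? xs) ≡ ∑ xs (𝟙 ∘ P?)
length-filter≡∑𝟙 P? []       = refl
length-filter≡∑𝟙 P? (x ∷ xs) with P? x
... | yes _ = cong suc (length-filter≡∑𝟙 P? xs)
... | no  _ = length-filter≡∑𝟙 P? xs

-- Dispersion of a natural-valued statistic with bounded fibres

∣-∣²+2mn : ∀ m n → ∣ m - n ∣ * ∣ m - n ∣ + 2 * (m * n) ≡ m * m + n * n
∣-∣²+2mn zero    n       = identity n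
  where
  identity : ∀ n → n * n + 2 * (0 * n) ≡ n * n
  identity = solve-∀
∣-∣²+2mn (suc m) zero    = identity (suc m)
  where
  identity : ∀ n → n * n + 2 * (n * 0) ≡ n * n + 0
  identity = solve-∀
∣-∣²+2mn (suc m) (suc n) = let d = ∣ m - n ∣ * ∣ m - n ∣ in begin-equality
  d + 2 * (suc m * suc n)                 ≡⟨ peel d m n ⟩
  d + 2 * (m * n) + (2 * m + 2 * n + 2)   ≡⟨ cong (_+ (2 * m + 2 * n + 2)) (∣-∣²+2mn m n) ⟩
  m * m + n * n + (2 * m + 2 * n + 2)     ≡⟨ collect m n ⟩
  suc m * suc m + suc n * suc n           ∎
  where
  peel : ∀ d m n → d + 2 * (suc m * suc n) ≡ d + 2 * (m * n) + (2 * m + 2 * n + 2)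
  peel = solve-∀
  collect : ∀ m n → m * m + n * n + (2 * m + 2 * n + 2) ≡ suc m * suc m + suc n * suc n
  collect = solve-∀

-- This number occurs in two roles: as the increment (k + 1)² - k², the weight of a layer, and as
-- the number of integers within distance k of a given one. Hence the sum of its squares below.
odd : ℕ → ℕ
odd k = 1 + 2 * k

∑odd² : ∀ K → 3 * ∑ (downFrom K) (λ k → odd k * odd k) + K ≡ 4 * (K * K * K)
∑odd² zero    = refl
∑odd² (suc K) = let S = ∑ (downFrom K) (λ k → odd k * odd k) in begin-equality
  3 * (odd K * odd K + S) + suc K                ≡⟨ peel S K ⟩
  3 * S + K + (3 * (odd K * odd K) + 1)          ≡⟨ cong (_+ (3 * (odd K * odd K) + 1)) (∑odd² K) ⟩
  4 * (K * K * K) + (3 * (odd K * odd K) + 1)    ≡⟨ collect K ⟩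
  4 * (suc K * suc K * suc K)                    ∎
  where
  peel : ∀ S K → 3 * ((1 + 2 * K) * (1 + 2 * K) + S) + suc K
                 ≡ 3 * S + K + (3 * ((1 + 2 * K) * (1 + 2 * K)) + 1)
  peel = solve-∀
  collect : ∀ K → 4 * (K * K * K) + (3 * ((1 + 2 * K) * (1 + 2 * K)) + 1) ≡ 4 * (suc K * suc K * suc K)
  collect = solve-∀

-- Layer cake: max(0, K² − d²) is the sum over k < K of (2k + 1) [d ≤ k].
parabola : ∀ d K → K * K ≤ d * d + ∑ (downFrom K) (λ k → odd k * 𝟙 (d ≤? k))
parabola d zero    = z≤n
parabola d (suc K) with ≤-<-connex d K
... | inj₁ d≤K = begin
  suc K * suc K                                                     ≡⟨ peel K ⟩
  odd K + K * K                                                     ≤⟨ +-monoʳ-≤ (odd K) (parabola d K) ⟩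
  odd K + (d * d + ∑ (downFrom K) (λ k → odd k * 𝟙 (d ≤? k)))       ≡⟨ collect (odd K) (d * d) _ ⟩
  d * d + (odd K * 1 + ∑ (downFrom K) (λ k → odd k * 𝟙 (d ≤? k)))
    ≡⟨ cong (λ u → d * d + (odd K * u + ∑ (downFrom K) (λ k → odd k * 𝟙 (d ≤? k))))
         (𝟙-true (d ≤? K) d≤K) ⟨
  d * d + ∑ (downFrom (suc K)) (λ k → odd k * 𝟙 (d ≤? k))           ∎
  where
  peel : ∀ K → suc K * suc K ≡ (1 + 2 * K) + K * K
  peel = solve-∀
  collect : ∀ a b c → a + (b + c) ≡ b + (a * 1 + c)
  collect = solve-∀
... | inj₂ K<d = ≤-trans (*-mono-≤ K<d K<d) (m≤m+n _ _)

-- The naturals within k of c lie among 2k + 1 consecutive ones starting at `c ∸ k`. If c < k,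
-- truncation shifts this window to start at 0, but it still reaches c + k < 2k + 1.
𝟙-window : ∀ c k v →
  𝟙 (∣ v - c ∣ ≤? k) ≤ ∑ (downFrom (odd k)) (λ i → 𝟙 (v ≟ (c ∸ k) + i))
𝟙-window c k v = 𝟙-≤ (∣ v - c ∣ ≤? k) inside
  where
  i = v ∸ (c ∸ k)
  identity : ∀ k a → k + a + k ≡ a + 2 * k
  identity = solve-∀
  inside : ∣ v - c ∣ ≤ k → 1 ≤ ∑ (downFrom (odd k)) (λ i → 𝟙 (v ≟ (c ∸ k) + i))
  inside ∣v-c∣≤k = begin
    1                    ≡⟨ 𝟙-true (v ≟ (c ∸ k) + i) (sym (m+[n∸m]≡n c∸k≤v)) ⟨
    𝟙 (v ≟ (c ∸ k) + i)  ≤⟨ ∑-∈ (λ i → 𝟙 (v ≟ (c ∸ k) + i)) (∈-downFrom⁺ i<2k+1) ⟩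
    ∑ (downFrom (odd k)) (λ i → 𝟙 (v ≟ (c ∸ k) + i)) ∎
    where
    c∸k≤v : c ∸ k ≤ v
    c∸k≤v = m≤n+o⇒m∸n≤o c k (begin
      c                  ≤⟨ m≤n+∣n-m∣ c v ⟩
      v + ∣ v - c ∣      ≤⟨ +-monoʳ-≤ v ∣v-c∣≤k ⟩
      v + k              ≡⟨ +-comm v k ⟩
      k + v              ∎)
    i<2k+1 : i < odd k
    i<2k+1 = s≤s (m≤n+o⇒m∸n≤o v (c ∸ k) (begin
      v                  ≤⟨ m≤n+∣m-n∣ v c ⟩
      c + ∣ v - c ∣      ≤⟨ +-mono-≤ (m≤n+m∸n c k) ∣v-c∣≤k ⟩
      k + (c ∸ k) + k    ≡⟨ identity k (c ∸ k) ⟩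
      (c ∸ k) + 2 * k    ∎))

module Spread (xs : List A) (X : A → ℕ) (M : ℕ)
              (fibre≤M : ∀ v → ∑ xs (λ x → 𝟙 (X x ≟ v)) ≤ M) where

  N A₁ A₂ : ℕ
  N  = length xs
  A₁ = ∑ xs X
  A₂ = ∑ xs (λ x → X x * X x)

  ball≤ : ∀ c k → ∑ xs (λ x → 𝟙 (∣ X x - c ∣ ≤? k)) ≤ odd k * M
  ball≤ c k = begin
    ∑ xs (λ x → 𝟙 (∣ X x - c ∣ ≤? k))
      ≤⟨ ∑-mono xs (λ x → 𝟙-window c k (X x)) ⟩
    ∑ xs (λ x → ∑ (downFrom (odd k)) (λ i → 𝟙 (X x ≟ (c ∸ k) + i)))
      ≡⟨ ∑-swap xs (downFrom (odd k)) _ ⟩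
    ∑ (downFrom (odd k)) (λ i → ∑ xs (λ x → 𝟙 (X x ≟ (c ∸ k) + i)))
      ≤⟨ ∑-mono (downFrom (odd k)) (λ i → fibre≤M ((c ∸ k) + i)) ⟩
    ∑ (downFrom (odd k)) (λ _ → M)
      ≡⟨ ∑-const (downFrom (odd k)) M ⟩
    length (downFrom (odd k)) * M
      ≡⟨ cong (_* M) (length-downFrom (odd k)) ⟩
    odd k * M ∎

  -- Sum `parabola` over the list and exchange the sums: layer k has weight 2k + 1 and covers at
  -- most (2k + 1) M points. The half-width K stays free until `dispersion` optimises it.
  spread : ∀ c K → N * (K * K) ≤
    ∑ xs (λ x → ∣ X x - c ∣ * ∣ X x - c ∣) + ∑ (downFrom K) (λ k → odd k * odd k) * M
  spread c K = begin
    N * (K * K)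
      ≡⟨ ∑-const xs (K * K) ⟨
    ∑ xs (λ _ → K * K)
      ≤⟨ ∑-mono xs (λ x → parabola ∣ X x - c ∣ K) ⟩
    ∑ xs (λ x → ∣ X x - c ∣ * ∣ X x - c ∣ + ∑ (downFrom K) (λ k → odd k * 𝟙 (∣ X x - c ∣ ≤? k)))
      ≡⟨ ∑-+ xs _ _ ⟩
    ∑ xs (λ x → ∣ X x - c ∣ * ∣ X x - c ∣) +
    ∑ xs (λ x → ∑ (downFrom K) (λ k → odd k * 𝟙 (∣ X x - c ∣ ≤? k)))
      ≡⟨ cong (∑ xs (λ x → ∣ X x - c ∣ * ∣ X x - c ∣) +_) (∑-swap xs (downFrom K) _) ⟩
    ∑ xs (λ x → ∣ X x - c ∣ * ∣ X x - c ∣) +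
    ∑ (downFrom K) (λ k → ∑ xs (λ x → odd k * 𝟙 (∣ X x - c ∣ ≤? k)))
      ≤⟨ +-monoʳ-≤ (∑ xs (λ x → ∣ X x - c ∣ * ∣ X x - c ∣)) (∑-mono (downFrom K) layer) ⟩
    ∑ xs (λ x → ∣ X x - c ∣ * ∣ X x - c ∣) + ∑ (downFrom K) (λ k → odd k * odd k * M)
      ≡⟨ cong (∑ xs (λ x → ∣ X x - c ∣ * ∣ X x - c ∣) +_) (∑-*ʳ (downFrom K) M _) ⟩
    ∑ xs (λ x → ∣ X x - c ∣ * ∣ X x - c ∣) + ∑ (downFrom K) (λ k → odd k * odd k) * M ∎
    where
    layer : ∀ k → ∑ xs (λ x → odd k * 𝟙 (∣ X x - c ∣ ≤? k)) ≤ odd k * odd k * M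
    layer k = begin
      ∑ xs (λ x → odd k * 𝟙 (∣ X x - c ∣ ≤? k))   ≡⟨ ∑-*ˡ xs (odd k) _ ⟩
      odd k * ∑ xs (λ x → 𝟙 (∣ X x - c ∣ ≤? k))   ≤⟨ *-monoʳ-≤ (odd k) (ball≤ c k) ⟩
      odd k * (odd k * M)                         ≡⟨ *-assoc (odd k) (odd k) M ⟨
      odd k * odd k * M                           ∎

  ∑∑∣-∣² : ∑ xs (λ y → ∑ xs (λ x → ∣ X x - X y ∣ * ∣ X x - X y ∣)) + 2 * (A₁ * A₁)
           ≡ 2 * (N * A₂)
  ∑∑∣-∣² = begin-equality
    ∑ xs (λ y → ∑ xs (λ x → ∣ X x - X y ∣ * ∣ X x - X y ∣)) + 2 * (A₁ * A₁)
      ≡⟨ cong (∑ xs (λ y → ∑ xs (λ x → ∣ X x - X y ∣ * ∣ X x - X y ∣)) +_) products ⟨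
    ∑ xs (λ y → ∑ xs (λ x → ∣ X x - X y ∣ * ∣ X x - X y ∣)) +
    ∑ xs (λ y → ∑ xs (λ x → 2 * (X x * X y)))
      ≡⟨ ∑-+ xs _ _ ⟨
    ∑ xs (λ y → ∑ xs (λ x → ∣ X x - X y ∣ * ∣ X x - X y ∣) + ∑ xs (λ x → 2 * (X x * X y)))
      ≡⟨ ∑-cong xs (λ y → sym (∑-+ xs _ _)) ⟩
    ∑ xs (λ y → ∑ xs (λ x → ∣ X x - X y ∣ * ∣ X x - X y ∣ + 2 * (X x * X y)))
      ≡⟨ ∑-cong xs (λ y → ∑-cong xs (λ x → ∣-∣²+2mn (X x) (X y))) ⟩
    ∑ xs (λ y → ∑ xs (λ x → X x * X x + X y * X y))
      ≡⟨ ∑-cong xs (λ y → trans (∑-+ xs _ _) (cong (A₂ +_) (∑-const xs _))) ⟩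
    ∑ xs (λ y → A₂ + N * (X y * X y))
      ≡⟨ trans (∑-+ xs _ _) (cong₂ _+_ (∑-const xs A₂) (∑-*ˡ xs N _)) ⟩
    N * A₂ + N * A₂
      ≡⟨ cong (N * A₂ +_) (sym (+-identityʳ (N * A₂))) ⟩
    2 * (N * A₂) ∎
    where
    products : ∑ xs (λ y → ∑ xs (λ x → 2 * (X x * X y))) ≡ 2 * (A₁ * A₁)
    products = begin-equality
      ∑ xs (λ y → ∑ xs (λ x → 2 * (X x * X y)))
        ≡⟨ ∑-cong xs (λ y → trans (∑-*ˡ xs 2 _) (cong (2 *_) (∑-*ʳ xs (X y) X))) ⟩
      ∑ xs (λ y → 2 * (A₁ * X y))
        ≡⟨ trans (∑-*ˡ xs 2 _) (cong (2 *_) (∑-*ˡ xs A₁ X)) ⟩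
      2 * (A₁ * A₁) ∎

  -- Each value `X y` serves in turn as the integer centre. By `∑∑∣-∣²` the squared distances then
  -- add up to 2N² times the variance, in which the mean no longer appears as a centre.
  pair-spread : ∀ K → N * (N * (K * K)) + 2 * (A₁ * A₁) ≤
    2 * (N * A₂) + N * (∑ (downFrom K) (λ k → odd k * odd k) * M)
  pair-spread K = begin
    N * (N * (K * K)) + 2 * (A₁ * A₁)
      ≡⟨ cong (_+ 2 * (A₁ * A₁)) (∑-const xs _) ⟨
    ∑ xs (λ _ → N * (K * K)) + 2 * (A₁ * A₁)
      ≤⟨ +-monoˡ-≤ (2 * (A₁ * A₁)) (∑-mono xs (λ y → spread (X y) K)) ⟩
    ∑ xs (λ y → ∑ xs (λ x → ∣ X x - X y ∣ * ∣ X x - X y ∣) + T) + 2 * (A₁ * A₁)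
      ≡⟨ cong (_+ 2 * (A₁ * A₁)) (trans (∑-+ xs _ _) (cong (D² +_) (∑-const xs T))) ⟩
    D² + N * T + 2 * (A₁ * A₁)
      ≡⟨ swapʳ D² (N * T) (2 * (A₁ * A₁)) ⟩
    D² + 2 * (A₁ * A₁) + N * T
      ≡⟨ cong (_+ N * T) ∑∑∣-∣² ⟩
    2 * (N * A₂) + N * T ∎
    where
    T  = ∑ (downFrom K) (λ k → odd k * odd k) * M
    D² = ∑ xs (λ y → ∑ xs (λ x → ∣ X x - X y ∣ * ∣ X x - X y ∣))
    swapʳ : ∀ a b c → a + b + c ≡ a + c + b
    swapʳ = solve-∀

sum-applyUpTo-cong : ∀ {f g : ℕ → ℕ} n → (∀ i → f i ≡ g i) →
  sum (applyUpTo f n) ≡ sum (applyUpTo g n)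
sum-applyUpTo-cong zero    f≡g = refl
sum-applyUpTo-cong (suc n) f≡g = cong₂ _+_ (f≡g 0) (sum-applyUpTo-cong n (λ i → f≡g (suc i)))

-- Tents whose half-width K is the integer nearest to N / 2M interpolate the
-- cubic N (N² − M²) / 12 M² from above, which is where the chord comes from.
dispersion : ∀ N M A₁ A₂ .{{_ : NonZero M}} →
  (∀ K → N * (N * (K * K)) + 2 * (A₁ * A₁) ≤
         2 * (N * A₂) + N * (∑ (downFrom K) (λ k → odd k * odd k) * M)) →
  N * N * (N * N) + 24 * (M * M) * (A₁ * A₁) ≤ N * N * (M * M) + 24 * (M * M) * (N * A₂)
dispersion N M A₁ A₂ pair = +-cancelʳ-≤ E _ _ (begin
  N * N * (N * N) + 24 * (M * M) * (A₁ * A₁) + E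
    ≡⟨ split N M A₁ y ⟩
  (N * N * (N * N) + 16 * N * (y * y * y)) +
  (12 * N * N * (y * y) + 24 * (M * M) * (A₁ * A₁) + 4 * N * (M * M) * y)
    ≤⟨ +-mono-≤ chord tents ⟩
  (N * N * (M * M) + 4 * N * (M * M) * y + 12 * N * N * (y * y)) +
  (24 * (M * M) * (N * A₂) + 16 * N * (y * y * y))
    ≡⟨ join N M A₂ y ⟩
  N * N * (M * M) + 24 * (M * M) * (N * A₂) + E ∎)
  where
  instance _ = m*n≢0 2 M
  K = (N + M) / (2 * M)
  ρ = (N + M) % (2 * M)
  S = ∑ (downFrom K) (λ k → odd k * odd k)
  y = M * K
  -- These are the terms in y that `chord` and `tents` carry on opposite sides; they occur on both
  -- sides of the sum of the two inequalities and cancel.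
  E = 16 * N * (y * y * y) + 12 * N * N * (y * y) + 4 * N * (M * M) * y

  split : ∀ N M A y → N * N * (N * N) + 24 * (M * M) * (A * A)
    + (16 * N * (y * y * y) + 12 * N * N * (y * y) + 4 * N * (M * M) * y)
    ≡ (N * N * (N * N) + 16 * N * (y * y * y)) +
      (12 * N * N * (y * y) + 24 * (M * M) * (A * A) + 4 * N * (M * M) * y)
  split = solve-∀
  join : ∀ N M A y →
    (N * N * (M * M) + 4 * N * (M * M) * y + 12 * N * N * (y * y)) +
    (24 * (M * M) * (N * A) + 16 * N * (y * y * y))
    ≡ N * N * (M * M) + 24 * (M * M) * (N * A)
    + (16 * N * (y * y * y) + 12 * N * N * (y * y) + 4 * N * (M * M) * y)
  join = solve-∀

  N+M≡ : N + M ≡ ρ + 2 * y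
  N+M≡ = trans (m≡m%n+[m/n]*n (N + M) (2 * M)) (cong (ρ +_) (assoc K M))
    where
    assoc : ∀ K M → K * (2 * M) ≡ 2 * (M * K)
    assoc = solve-∀

  ∣N-2y∣≤M : ∣ N - 2 * y ∣ ≤ M
  ∣N-2y∣≤M with ≤-total N (2 * y)
  ... | inj₁ N≤2y = subst (_≤ M) (sym (m≤n⇒∣m-n∣≡n∸m N≤2y))
    (m≤n+o⇒m∸n≤o (2 * y) N (≤-trans (m≤n+m (2 * y) ρ) (≤-reflexive (sym N+M≡))))
  ... | inj₂ 2y≤N = subst (_≤ M) (sym (m≤n⇒∣n-m∣≡n∸m 2y≤N))
    (m≤n+o⇒m∸n≤o N (2 * y) (+-cancelʳ-≤ M N (2 * y + M) (begin
      N + M             ≡⟨ N+M≡ ⟩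
      ρ + 2 * y         ≤⟨ +-monoˡ-≤ (2 * y) (<⇒≤ (m%n<n (N + M) (2 * M))) ⟩
      2 * M + 2 * y     ≡⟨ regroup M y ⟩
      2 * y + M + M     ∎)))
    where
    regroup : ∀ M y → 2 * M + 2 * y ≡ 2 * y + M + M
    regroup = solve-∀

  square : N * N + 4 * (y * y) ≤ M * M + 4 * (N * y)
  square = begin
    N * N + 4 * (y * y)
      ≡⟨ expand N y ⟩
    N * N + 2 * y * (2 * y)
      ≡⟨ ∣-∣²+2mn N (2 * y) ⟨
    ∣ N - 2 * y ∣ * ∣ N - 2 * y ∣ + 2 * (N * (2 * y))
      ≤⟨ +-monoˡ-≤ (2 * (N * (2 * y))) (*-mono-≤ ∣N-2y∣≤M ∣N-2y∣≤M) ⟩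
    M * M + 2 * (N * (2 * y))
      ≡⟨ regroup M N y ⟩
    M * M + 4 * (N * y) ∎
    where
    expand : ∀ N y → N * N + 4 * (y * y) ≡ N * N + 2 * y * (2 * y)
    expand = solve-∀
    regroup : ∀ M N y → M * M + 2 * (N * (2 * y)) ≡ M * M + 4 * (N * y)
    regroup = solve-∀

  -- Since N³ - 12Ny² + 16y³ = (N - 2y)² (N + 4y), this is `square`, that is (N - 2y)² ≤ M²,
  -- multiplied by N (N + 4y).
  chord : N * N * (N * N) + 16 * N * (y * y * y) ≤
          N * N * (M * M) + 4 * N * (M * M) * y + 12 * N * N * (y * y)
  chord = +-cancelʳ-≤ (4 * N * N * (y * y) + 4 * N * N * N * y) _ _ (begin
    N * N * (N * N) + 16 * N * (y * y * y) + (4 * N * N * (y * y) + 4 * N * N * N * y)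
      ≡⟨ factor N y ⟩
    N * (N + 4 * y) * (N * N + 4 * (y * y))
      ≤⟨ *-monoʳ-≤ (N * (N + 4 * y)) square ⟩
    N * (N + 4 * y) * (M * M + 4 * (N * y))
      ≡⟨ expand M N y ⟩
    N * N * (M * M) + 4 * N * (M * M) * y + 12 * N * N * (y * y)
      + (4 * N * N * (y * y) + 4 * N * N * N * y) ∎)
    where
    factor : ∀ N y →
      N * N * (N * N) + 16 * N * (y * y * y) + (4 * N * N * (y * y) + 4 * N * N * N * y)
      ≡ N * (N + 4 * y) * (N * N + 4 * (y * y))
    factor = solve-∀
    expand : ∀ M N y → N * (N + 4 * y) * (M * M + 4 * (N * y))
      ≡ N * N * (M * M) + 4 * N * (M * M) * y + 12 * N * N * (y * y)
      + (4 * N * N * (y * y) + 4 * N * N * N * y)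
    expand = solve-∀

  -- The hypothesis at K times 12M², rewritten in y = MK. The extra term 4NM²y completes 3S to 3S +
  -- K, which `∑odd²` evaluates to 4K³.
  tents : 12 * N * N * (y * y) + 24 * (M * M) * (A₁ * A₁) + 4 * N * (M * M) * y ≤
          24 * (M * M) * (N * A₂) + 16 * N * (y * y * y)
  tents = begin
    12 * N * N * (y * y) + 24 * (M * M) * (A₁ * A₁) + 4 * N * (M * M) * y
      ≡⟨ factor N M A₁ K ⟩
    12 * (M * M) * (N * (N * (K * K)) + 2 * (A₁ * A₁)) + 4 * N * (M * M) * y
      ≤⟨ +-monoˡ-≤ (4 * N * (M * M) * y) (*-monoʳ-≤ (12 * (M * M)) (pair K)) ⟩
    12 * (M * M) * (2 * (N * A₂) + N * (S * M)) + 4 * N * (M * M) * y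
      ≡⟨ collect N M A₂ S K ⟩
    24 * (M * M) * (N * A₂) + 4 * N * (M * M * M) * (3 * S + K)
      ≡⟨ cong (λ u → 24 * (M * M) * (N * A₂) + 4 * N * (M * M * M) * u) (∑odd² K) ⟩
    24 * (M * M) * (N * A₂) + 4 * N * (M * M * M) * (4 * (K * K * K))
      ≡⟨ cong (24 * (M * M) * (N * A₂) +_) (cube N M K) ⟩
    24 * (M * M) * (N * A₂) + 16 * N * (y * y * y) ∎
    where
    factor : ∀ N M A K →
      12 * N * N * (M * K * (M * K)) + 24 * (M * M) * (A * A) + 4 * N * (M * M) * (M * K)
      ≡ 12 * (M * M) * (N * (N * (K * K)) + 2 * (A * A)) + 4 * N * (M * M) * (M * K)
    factor = solve-∀
    collect : ∀ N M A S K →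
      12 * (M * M) * (2 * (N * A) + N * (S * M)) + 4 * N * (M * M) * (M * K)
      ≡ 24 * (M * M) * (N * A) + 4 * N * (M * M * M) * (3 * S + K)
    collect = solve-∀
    cube : ∀ N M K → 4 * N * (M * M * M) * (4 * (K * K * K))
                     ≡ 16 * N * (M * K * (M * K) * (M * K))
    cube = solve-∀

-- Mean and variance of a single digit

-- With h = 1 + g, this is 180 times the variance of x (h − x) for x uniform in {0, …, h}.
180σ² : ℕ → ℕ
180σ² g = g * (1 + g) * (3 + g) * (4 + g)

-- The offset t makes the induction on h close: after the term i = 0 is removed, the rest is the
-- ramp of the smaller h with offset t + 1. The case wanted later is t = 0.
∑ramp : ∀ h t → 6 * sum (applyUpTo (λ i → (i + t) * (h ∸ i)) (suc h)) + h * (h + 1)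
                ≡ h * (h + 1) * (h + 3 * t)
∑ramp zero    t = cong (λ u → 6 * (u + 0) + 0) (*-zeroʳ t)
∑ramp (suc h) t = begin-equality
  6 * (t * suc h + sum (applyUpTo (λ i → (suc i + t) * (h ∸ i)) (suc h))) + suc h * (suc h + 1)
    ≡⟨ cong (λ u → 6 * (t * suc h + u) + suc h * (suc h + 1)) (shift (suc h)) ⟩
  6 * (t * suc h + s) + suc h * (suc h + 1)
    ≡⟨ peel h t s ⟩
  6 * s + h * (h + 1) + (6 * (t * suc h) + 2 * suc h)
    ≡⟨ cong (_+ (6 * (t * suc h) + 2 * suc h)) (∑ramp h (suc t)) ⟩
  h * (h + 1) * (h + 3 * suc t) + (6 * (t * suc h) + 2 * suc h)
    ≡⟨ collect h t ⟩
  suc h * (suc h + 1) * (suc h + 3 * t) ∎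
  where
  s = sum (applyUpTo (λ i → (i + suc t) * (h ∸ i)) (suc h))
  shift : ∀ k → sum (applyUpTo (λ i → (suc i + t) * (h ∸ i)) k)
                ≡ sum (applyUpTo (λ i → (i + suc t) * (h ∸ i)) k)
  shift k = sum-applyUpTo-cong k (λ i → cong (_* (h ∸ i)) (sym (+-suc i t)))
  peel : ∀ h t s → 6 * (t * suc h + s) + suc h * (suc h + 1)
                   ≡ 6 * s + h * (h + 1) + (6 * (t * suc h) + 2 * suc h)
  peel = solve-∀
  collect : ∀ h t → h * (h + 1) * (h + 3 * suc t) + (6 * (t * suc h) + 2 * suc h)
                    ≡ suc h * (suc h + 1) * (suc h + 3 * t)
  collect = solve-∀

-- The same induction with a moving offset. The sum is a quadratic polynomial in t, and the equation
-- is its closed form with the negative part on the left.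
∑ramp² : ∀ h t →
  30 * sum (applyUpTo (λ i → (i + t) * (h ∸ i) * ((i + t) * (h ∸ i))) (suc h))
    + h * (h + 1) * (5 * (h * t) + h * h + 1)
  ≡ h * (h + 1) * (5 * (2 * h + 1) * (t * t) + 5 * (h * h * t) + h * h * h + h)
∑ramp² zero    t rewrite *-zeroʳ t = refl
∑ramp² (suc h) t = begin-equality
  30 * (t * suc h * (t * suc h)
        + sum (applyUpTo (λ i → (suc i + t) * (h ∸ i) * ((suc i + t) * (h ∸ i))) (suc h)))
    + suc h * (suc h + 1) * (5 * (suc h * t) + suc h * suc h + 1)
    ≡⟨ cong (λ u → 30 * (t * suc h * (t * suc h) + u)
                   + suc h * (suc h + 1) * (5 * (suc h * t) + suc h * suc h + 1)) (shift (suc h)) ⟩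
  30 * (t * suc h * (t * suc h) + s)
    + suc h * (suc h + 1) * (5 * (suc h * t) + suc h * suc h + 1)
    -- The negative parts for h and h + 1 differ, so the one for h is added to both sides before the
    -- induction hypothesis is applied.
    ≡⟨ +-cancelʳ-≡ (h * (h + 1) * (5 * (h * suc t) + h * h + 1)) _ _ (begin-equality
      30 * (t * suc h * (t * suc h) + s)
        + suc h * (suc h + 1) * (5 * (suc h * t) + suc h * suc h + 1)
        + h * (h + 1) * (5 * (h * suc t) + h * h + 1)
        ≡⟨ peel h t s ⟩
      30 * s + h * (h + 1) * (5 * (h * suc t) + h * h + 1)
        + (30 * (t * suc h * (t * suc h))
           + suc h * (suc h + 1) * (5 * (suc h * t) + suc h * suc h + 1))
        ≡⟨ cong (_+ (30 * (t * suc h * (t * suc h))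
           + suc h * (suc h + 1) * (5 * (suc h * t) + suc h * suc h + 1))) (∑ramp² h (suc t)) ⟩
      h * (h + 1) * (5 * (2 * h + 1) * (suc t * suc t) + 5 * (h * h * suc t) + h * h * h + h)
        + (30 * (t * suc h * (t * suc h))
           + suc h * (suc h + 1) * (5 * (suc h * t) + suc h * suc h + 1))
        ≡⟨ collect h t ⟩
      suc h * (suc h + 1) * (5 * (2 * suc h + 1) * (t * t) + 5 * (suc h * suc h * t)
                             + suc h * suc h * suc h + suc h)
        + h * (h + 1) * (5 * (h * suc t) + h * h + 1) ∎) ⟩
  suc h * (suc h + 1) * (5 * (2 * suc h + 1) * (t * t) + 5 * (suc h * suc h * t)
                         + suc h * suc h * suc h + suc h) ∎
  where
  s = sum (applyUpTo (λ i → (i + suc t) * (h ∸ i) * ((i + suc t) * (h ∸ i))) (suc h))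
  shift : ∀ k → sum (applyUpTo (λ i → (suc i + t) * (h ∸ i) * ((suc i + t) * (h ∸ i))) k)
                ≡ sum (applyUpTo (λ i → (i + suc t) * (h ∸ i) * ((i + suc t) * (h ∸ i))) k)
  shift k = sum-applyUpTo-cong k (λ i → cong (λ u → u * (h ∸ i) * (u * (h ∸ i))) (sym (+-suc i t)))
  peel : ∀ h t s → 30 * (t * suc h * (t * suc h) + s)
        + suc h * (suc h + 1) * (5 * (suc h * t) + suc h * suc h + 1)
        + h * (h + 1) * (5 * (h * suc t) + h * h + 1)
      ≡ 30 * s + h * (h + 1) * (5 * (h * suc t) + h * h + 1)
        + (30 * (t * suc h * (t * suc h))
           + suc h * (suc h + 1) * (5 * (suc h * t) + suc h * suc h + 1))
  peel = solve-∀
  collect : ∀ h t →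
      h * (h + 1) * (5 * (2 * h + 1) * (suc t * suc t) + 5 * (h * h * suc t) + h * h * h + h)
        + (30 * (t * suc h * (t * suc h))
           + suc h * (suc h + 1) * (5 * (suc h * t) + suc h * suc h + 1))
      ≡ suc h * (suc h + 1) * (5 * (2 * suc h + 1) * (t * t) + 5 * (suc h * suc h * t)
                             + suc h * suc h * suc h + suc h)
        + h * (h + 1) * (5 * (h * suc t) + h * h + 1)
  collect = solve-∀

-- h²/4 − (x − h/2)²: the squared distance to the centre h/2, made integral.
bump : ℕ → ℕ → ℕ
bump h x = x * (h ∸ x)

module Digits (g : ℕ) where

  private h = suc g

  S₁ S₂ : ℕ
  S₁ = sum (applyUpTo (bump h) (suc h))
  S₂ = sum (applyUpTo (λ x → bump h x * bump h x) (suc h))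

  6S₁ : 6 * S₁ ≡ g * (1 + g) * (2 + g)
  6S₁ = +-cancelʳ-≡ (h * (h + 1)) _ _ (begin-equality
    6 * S₁ + h * (h + 1)
      ≡⟨ cong (λ u → 6 * u + h * (h + 1)) (sum-applyUpTo-cong (suc h)
           (λ i → cong (_* (h ∸ i)) (sym (+-identityʳ i)))) ⟩
    6 * sum (applyUpTo (λ i → (i + 0) * (h ∸ i)) (suc h)) + h * (h + 1)
      ≡⟨ ∑ramp h 0 ⟩
    h * (h + 1) * (h + 3 * 0)
      ≡⟨ expand g ⟩
    g * (1 + g) * (2 + g) + h * (h + 1) ∎)
    where
    expand : ∀ g → suc g * (suc g + 1) * (suc g + 3 * 0)
                   ≡ g * (1 + g) * (2 + g) + suc g * (suc g + 1)
    expand = solve-∀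

  30S₂ : 30 * S₂ ≡ g * (1 + g) * (2 + g) * (h * h + 1)
  30S₂ = +-cancelʳ-≡ (h * (h + 1) * (5 * (h * 0) + h * h + 1)) _ _ (begin-equality
    30 * S₂ + h * (h + 1) * (5 * (h * 0) + h * h + 1)
      ≡⟨ cong (λ u → 30 * u + h * (h + 1) * (5 * (h * 0) + h * h + 1))
           (sum-applyUpTo-cong (suc h)
             (λ i → cong (λ u → u * (h ∸ i) * (u * (h ∸ i))) (sym (+-identityʳ i)))) ⟩
    30 * sum (applyUpTo (λ i → (i + 0) * (h ∸ i) * ((i + 0) * (h ∸ i))) (suc h))
      + h * (h + 1) * (5 * (h * 0) + h * h + 1)
      ≡⟨ ∑ramp² h 0 ⟩
    h * (h + 1) * (5 * (2 * h + 1) * (0 * 0) + 5 * (h * h * 0) + h * h * h + h)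
      ≡⟨ expand g ⟩
    g * (1 + g) * (2 + g) * (h * h + 1) + h * (h + 1) * (5 * (h * 0) + h * h + 1) ∎)
    where
    expand : ∀ g →
      suc g * (suc g + 1) * (5 * (2 * suc g + 1) * (0 * 0) + 5 * (suc g * suc g * 0)
                             + suc g * suc g * suc g + suc g)
      ≡ g * (1 + g) * (2 + g) * (suc g * suc g + 1)
        + suc g * (suc g + 1) * (5 * (suc g * 0) + suc g * suc g + 1)
    expand = solve-∀

  -- Squaring 6S₁ brings in 36 and the second moment brings in 30; 180 is their least common
  -- multiple.
  variance : 180 * (S₁ * S₁) + suc h * suc h * 180σ² g ≡ 180 * (suc h * S₂)
  variance = begin-equality
    180 * (S₁ * S₁) + suc h * suc h * 180σ² g
      ≡⟨ regroup S₁ (suc h * suc h * 180σ² g) ⟩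
    5 * (6 * S₁ * (6 * S₁)) + suc h * suc h * 180σ² g
      ≡⟨ cong (λ u → 5 * (u * u) + suc h * suc h * 180σ² g) 6S₁ ⟩
    5 * (g * (1 + g) * (2 + g) * (g * (1 + g) * (2 + g))) + suc h * suc h * 180σ² g
      ≡⟨ identity g ⟩
    6 * suc h * (g * (1 + g) * (2 + g) * (h * h + 1))
      ≡⟨ cong (6 * suc h *_) 30S₂ ⟨
    6 * suc h * (30 * S₂)
      ≡⟨ collect (suc h) S₂ ⟩
    180 * (suc h * S₂) ∎
    where
    regroup : ∀ s e → 180 * (s * s) + e ≡ 5 * (6 * s * (6 * s)) + e
    regroup = solve-∀
    identity : ∀ g →
      5 * (g * (1 + g) * (2 + g) * (g * (1 + g) * (2 + g)))
        + suc (suc g) * suc (suc g) * (g * (1 + g) * (3 + g) * (4 + g))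
      ≡ 6 * suc (suc g) * (g * (1 + g) * (2 + g) * (suc g * suc g + 1))
    identity = solve-∀
    collect : ∀ k s → 6 * k * (30 * s) ≡ 180 * (k * s)
    collect = solve-∀

-- Product sets and additivity of the variance

length-cartesianProductWith : ∀ (f : A → B → D) xs ys →
  length (cartesianProductWith f xs ys) ≡ length xs * length ys
length-cartesianProductWith f []       ys = refl
length-cartesianProductWith f (x ∷ xs) ys = trans (length-++ (map (f x) ys))
  (cong₂ _+_ (length-map (f x) ys) (length-cartesianProductWith f xs ys))

cube : List A → ∀ n → List (Vec A n)
cube ds zero    = [] ∷ []
cube ds (suc n) = cartesianProductWith _∷_ ds (cube ds n)

total : ∀ {n} → (A → ℕ) → Vec A n → ℕ
total f []       = 0
total f (x ∷ xs) = f x + total f xs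

length-cube : ∀ (ds : List A) n → length (cube ds n) ≡ length ds ^ n
length-cube ds zero    = refl
length-cube ds (suc n) =
  trans (length-cartesianProductWith _∷_ ds (cube ds n)) (cong (length ds *_) (length-cube ds n))

cube-unique : ∀ {ds : List A} → Uniqueˡ ds → ∀ n → Uniqueˡ (cube ds n)
cube-unique uniq zero    = [] ∷ []
cube-unique uniq (suc n) =
  Uniqueˡ.cartesianProductWith⁺ _∷_ ∷-injective uniq (cube-unique uniq n)

∈-cube⁻ : ∀ {P : A → Set} {ds : List A} → (∀ {x} → x ∈ˡ ds → P x) →
          ∀ {n} {v : Vec A n} → v ∈ˡ cube ds n → All P v
∈-cube⁻ Pds {zero}  {[]} _ = []
∈-cube⁻ {ds = ds} Pds {suc n} v∈ with ∈-cartesianProductWith⁻ _∷_ ds (cube ds n) v∈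
... | _ , _ , x∈ , xs∈ , refl = Pds x∈ ∷ ∈-cube⁻ Pds xs∈

module Moments (ds : List A) (f : A → ℕ) where

  A₁ A₂ : ℕ → ℕ
  A₁ n = ∑ (cube ds n) (total f)
  A₂ n = ∑ (cube ds n) (λ v → total f v * total f v)

  private
    k a₁ a₂ : ℕ
    k  = length ds
    a₁ = ∑ ds f
    a₂ = ∑ ds (λ x → f x * f x)

    N : ℕ → ℕ
    N n = length (cube ds n)

  A₁-suc : ∀ n → A₁ (suc n) ≡ N n * a₁ + k * A₁ n
  A₁-suc n = begin-equality
    A₁ (suc n)
      ≡⟨ ∑-cartesianProductWith _∷_ ds (cube ds n) (total f) ⟩
    ∑ ds (λ x → ∑ (cube ds n) (λ v → f x + total f v))
      ≡⟨ ∑-cong ds (λ x → trans (∑-+ (cube ds n) _ _)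
           (cong (_+ A₁ n) (∑-const (cube ds n) (f x)))) ⟩
    ∑ ds (λ x → N n * f x + A₁ n)
      ≡⟨ trans (∑-+ ds _ _) (cong₂ _+_ (∑-*ˡ ds (N n) f) (∑-const ds (A₁ n))) ⟩
    N n * a₁ + k * A₁ n ∎

  A₂-suc : ∀ n → A₂ (suc n) ≡ N n * a₂ + 2 * A₁ n * a₁ + k * A₂ n
  A₂-suc n = begin-equality
    A₂ (suc n)
      ≡⟨ ∑-cartesianProductWith _∷_ ds (cube ds n) _ ⟩
    ∑ ds (λ x → ∑ (cube ds n) (λ v → (f x + total f v) * (f x + total f v)))
      ≡⟨ ∑-cong ds (λ x → ∑-cong (cube ds n) (λ v → square (f x) (total f v))) ⟩
    ∑ ds (λ x → ∑ (cube ds n) (λ v → f x * f x + 2 * f x * total f v + total f v * total f v))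
      ≡⟨ ∑-cong ds (λ x → trans (∑-+ (cube ds n) _ _) (cong (_+ A₂ n)
           (trans (∑-+ (cube ds n) _ _)
             (cong₂ _+_ (∑-const (cube ds n) _) (∑-*ˡ (cube ds n) (2 * f x) _))))) ⟩
    ∑ ds (λ x → N n * (f x * f x) + 2 * f x * A₁ n + A₂ n)
      ≡⟨ ∑-cong ds (λ x → cong (λ u → N n * (f x * f x) + u + A₂ n) (swap (f x) (A₁ n))) ⟩
    ∑ ds (λ x → N n * (f x * f x) + 2 * A₁ n * f x + A₂ n)
      ≡⟨ trans (∑-+ ds _ _) (cong₂ _+_
           (trans (∑-+ ds _ _) (cong₂ _+_ (∑-*ˡ ds (N n) _) (∑-*ˡ ds (2 * A₁ n) f)))
           (∑-const ds (A₂ n))) ⟩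
    N n * a₂ + 2 * A₁ n * a₁ + k * A₂ n ∎
    where
    square : ∀ a b → (a + b) * (a + b) ≡ a * a + 2 * a * b + b * b
    square = solve-∀
    swap : ∀ a b → 2 * a * b ≡ 2 * b * a
    swap = solve-∀

  -- Variances of independent coordinates add; P / c is the variance of one coordinate. The cross
  -- terms 2cN a₁ k A₁ from squaring the mean and from the second moment agree, so they cancel
  -- across the equation.
  variance-cube : ∀ c P → c * (a₁ * a₁) + k * k * P ≡ c * (k * a₂) →
    ∀ n → c * (A₁ n * A₁ n) + n * (N n * N n) * P ≡ c * (N n * A₂ n)
  variance-cube c P base zero    = +-identityʳ (c * 0)
  variance-cube c P base (suc n) = begin-equality
    c * (A₁ (suc n) * A₁ (suc n)) + suc n * (N (suc n) * N (suc n)) * P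
      ≡⟨ cong₂ (λ a b → c * (a * a) + suc n * (b * b) * P) (A₁-suc n) N-suc ⟩
    c * ((N n * a₁ + k * A₁ n) * (N n * a₁ + k * A₁ n)) + suc n * (k * N n * (k * N n)) * P
      ≡⟨ split c (N n) k a₁ (A₁ n) n P ⟩
    N n * N n * (c * (a₁ * a₁) + k * k * P)
      + k * k * (c * (A₁ n * A₁ n) + n * (N n * N n) * P)
      + 2 * c * (N n * a₁ * (k * A₁ n))
      ≡⟨ cong₂ (λ a b → N n * N n * a + k * k * b + 2 * c * (N n * a₁ * (k * A₁ n)))
           base (variance-cube c P base n) ⟩
    N n * N n * (c * (k * a₂)) + k * k * (c * (N n * A₂ n)) + 2 * c * (N n * a₁ * (k * A₁ n))
      ≡⟨ join c (N n) k a₁ a₂ (A₁ n) (A₂ n) ⟩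
    c * (k * N n * (N n * a₂ + 2 * A₁ n * a₁ + k * A₂ n))
      ≡⟨ cong₂ (λ a b → c * (a * b)) N-suc (A₂-suc n) ⟨
    c * (N (suc n) * A₂ (suc n)) ∎
    where
    N-suc : N (suc n) ≡ k * N n
    N-suc = length-cartesianProductWith _∷_ ds (cube ds n)
    split : ∀ c N k a A n P →
      c * ((N * a + k * A) * (N * a + k * A)) + suc n * (k * N * (k * N)) * P
      ≡ N * N * (c * (a * a) + k * k * P) + k * k * (c * (A * A) + n * (N * N) * P)
        + 2 * c * (N * a * (k * A))
    split = solve-∀
    join : ∀ c N k a b A B →
      N * N * (c * (k * b)) + k * k * (c * (N * B)) + 2 * c * (N * a * (k * A))
      ≡ c * (k * N * (N * b + 2 * A * a + k * B))
    join = solve-∀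

-- The parallelogram law modulo 2h

-- As `bump h x` is a constant minus (x - h/2)², this is the parallelogram law for a, c and their
-- midpoint. Writing the points through the gaps t and s turns every truncated difference into a
-- genuine sum.
bump-step : ∀ a t s → let b = a + t; c = b + t; h = c + s in
  4 * bump h b ≡ 2 * bump h a + 2 * bump h c + ∣ a - c ∣ * ∣ a - c ∣
bump-step a t s = let b = a + t; c = b + t; h = c + s in begin-equality
  4 * (b * (h ∸ b))
    ≡⟨ cong (λ z → 4 * (b * z)) (trans (cong (_∸ b) (+-assoc b t s)) (m+n∸m≡n b (t + s))) ⟩
  4 * (b * (t + s))
    ≡⟨ identity a t s ⟩
  2 * (a * (t + t + s)) + 2 * (c * s) + (t + t) * (t + t)
    ≡⟨ cong₂ _+_ (cong₂ (λ y z → 2 * (a * y) + 2 * (c * z)) h∸a (m+n∸m≡n c s))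
                 (cong₂ _*_ ∣a-c∣ ∣a-c∣) ⟨
  2 * bump h a + 2 * bump h c + ∣ a - c ∣ * ∣ a - c ∣ ∎
  where
  identity : ∀ a t s → 4 * ((a + t) * (t + s))
    ≡ 2 * (a * (t + t + s)) + 2 * ((a + t + t) * s) + (t + t) * (t + t)
  identity = solve-∀
  assoc : ∀ a t s → a + t + t + s ≡ a + (t + t + s)
  assoc = solve-∀
  h∸a : a + t + t + s ∸ a ≡ t + t + s
  h∸a = trans (cong (_∸ a) (assoc a t s)) (m+n∸m≡n a (t + t + s))
  ∣a-c∣ : ∣ a - (a + t + t) ∣ ≡ t + t
  ∣a-c∣ = trans (cong (∣ a -_∣) (+-assoc a t t)) (∣m-m+n∣≡n a (t + t))

steps-equal : ∀ a t u → a + (a + t + u) ≡ a + t + (a + t) → u ≡ t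
steps-equal a t u e = +-cancelˡ-≡ (a + t + a) u t
  (trans (regroup a t u) (trans e (regroup′ a t)))
  where
  regroup : ∀ a t u → a + t + a + u ≡ a + (a + t + u)
  regroup = solve-∀
  regroup′ : ∀ a t → a + t + (a + t) ≡ a + t + a + t
  regroup′ = solve-∀

bump-progression : ∀ h {a b c} → a ≤ b → b ≤ c → c ≤ h → a + c ≡ b + b →
  4 * bump h b ≡ 2 * bump h a + 2 * bump h c + ∣ a - c ∣ * ∣ a - c ∣
bump-progression h {a} a≤b b≤c c≤h e
  with m≤n⇒∃[o]m+o≡n a≤b | m≤n⇒∃[o]m+o≡n b≤c | m≤n⇒∃[o]m+o≡n c≤h
... | t , refl | u , refl | s , refl
  with refl ← steps-equal a t u e = bump-step a t s

bump-midpoint : ∀ h {a b c} → a ≤ h → c ≤ h → a + c ≡ b + b →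
  4 * bump h b ≡ 2 * bump h a + 2 * bump h c + ∣ a - c ∣ * ∣ a - c ∣
bump-midpoint h {a} {b} {c} a≤h c≤h e with ≤-total a b
... | inj₁ a≤b = bump-progression h a≤b b≤c c≤h e
  where
  b≤c : b ≤ c
  b≤c = +-cancelˡ-≤ a b c (≤-trans (+-monoˡ-≤ b a≤b) (≤-reflexive (sym e)))
... | inj₂ b≤a = trans (bump-progression h c≤b b≤a a≤h (trans (+-comm c a) e))
  (cong₂ _+_ (+-comm (2 * bump h c) (2 * bump h a)) (cong (λ z → z * z) (∣-∣-comm c a)))
  where
  c≤b : c ≤ b
  c≤b = +-cancelˡ-≤ a c b (≤-trans (≤-reflexive e) (+-monoˡ-≤ b b≤a))

extremes : ∀ {h a c} → a ≤ h → c ≤ h → h + h ≤ a + c → a ≡ h × c ≡ h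
extremes {h} {a} {c} a≤h c≤h le =
  ≤-antisym a≤h (+-cancelʳ-≤ h h a (≤-trans le (+-monoʳ-≤ a c≤h))) ,
  ≤-antisym c≤h (+-cancelˡ-≤ h h c (≤-trans le (+-monoˡ-≤ c a≤h)))

bump-h : ∀ h → bump h h ≡ 0
bump-h h = trans (cong (h *_) (n∸n≡0 h)) (*-zeroʳ h)

-- At least one full turn on the right forces a + c ≥ 2h, hence a = c = h and then b = 0, and every
-- term vanishes.
bump-wrap-up : ∀ {h a b c} t → a ≤ h → c ≤ h → a + c ≡ b + b + suc t * (h + h) →
  4 * bump h b ≡ 2 * bump h a + 2 * bump h c + ∣ a - c ∣ * ∣ a - c ∣
bump-wrap-up {h} {a} {b} {c} t a≤h c≤h e
  with extremes a≤h c≤h (≤-trans (m≤m+n (h + h) (t * (h + h)))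
         (≤-trans (m≤n+m (suc t * (h + h)) (b + b)) (≤-reflexive (sym e))))
... | refl , refl
  with refl ← m+n≡0⇒m≡0 b (m+n≡0⇒m≡0 (b + b) {t * (h + h)} (+-cancelʳ-≡ (h + h) _ _
         (trans (trans (+-assoc (b + b) _ _) (cong (b + b +_) (+-comm (t * (h + h)) (h + h)))) (sym e))))
  rewrite bump-h h | ∣n-n∣≡0 h = refl

bump-wrap-down : ∀ {h a b c} t → b ≤ h → a + c + suc t * (h + h) ≡ b + b →
  4 * bump h b ≡ 2 * bump h a + 2 * bump h c + ∣ a - c ∣ * ∣ a - c ∣
bump-wrap-down {h} {a} {b} {c} t b≤h e
  with extremes b≤h b≤h (≤-trans (m≤m+n (h + h) (t * (h + h)))
         (≤-trans (m≤n+m (suc t * (h + h)) (a + c)) (≤-reflexive e)))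
... | refl , _
  with m+n≡0⇒m≡0 (a + c) {t * (h + h)} (+-cancelʳ-≡ (h + h) _ _
         (trans (trans (+-assoc (a + c) _ _) (cong (a + c +_) (+-comm (t * (h + h)) (h + h)))) e))
... | a+c≡0 with refl ← m+n≡0⇒m≡0 a a+c≡0 | refl ← m+n≡0⇒n≡0 a a+c≡0
  rewrite bump-h h = refl

-- A sum of two numbers in {0, …, h} lies in {0, …, 2h}, so modulo 2h a progression can
-- wrap around only as (0, h, 0) or (h, 0, h), and x (h − x) vanishes at 0 and at h.
bump-mod : ∀ h {a b c} e e′ → a ≤ h → b ≤ h → c ≤ h →
  a + c + e′ * (h + h) ≡ b + b + e * (h + h) →
  4 * bump h b ≡ 2 * bump h a + 2 * bump h c + ∣ a - c ∣ * ∣ a - c ∣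
bump-mod h {b = b} zero    zero     a≤h b≤h c≤h eq =
  bump-midpoint h {b = b} a≤h c≤h (trans (sym (+-identityʳ _)) (trans eq (+-identityʳ _)))
bump-mod h {b = b} (suc e) zero     a≤h b≤h c≤h eq =
  bump-wrap-up {b = b} e a≤h c≤h (trans (sym (+-identityʳ _)) eq)
bump-mod h {a} {b} {c} zero (suc e′) a≤h b≤h c≤h eq =
  bump-wrap-down {a = a} {c = c} e′ b≤h (trans eq (+-identityʳ _))
bump-mod h {a} {b} {c} (suc e) (suc e′) a≤h b≤h c≤h eq =
  bump-mod h e e′ a≤h b≤h c≤h (+-cancelˡ-≡ (h + h) _ _
    (trans (rotate (h + h) (a + c) (e′ * (h + h)))
      (trans eq (sym (rotate (h + h) (b + b) (e * (h + h)))))))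
  where
  rotate : ∀ x y z → x + (y + z) ≡ y + (x + z)
  rotate = solve-∀

+ₘ-quotient : ∀ {m} (i j : Fin m) → ∃[ e ] toℕ i + toℕ j ≡ toℕ (i +ₘ j) + e * m
+ₘ-quotient {suc m} i j = s / suc m ,
  trans (m≡m%n+[m/n]*n s (suc m)) (cong (_+ s / suc m * suc m) (sym (toℕ-fromℕ< (m%n<n s (suc m)))))
  where s = toℕ i + toℕ j

weight : ∀ {m} → ℕ → Fin m → ℕ
weight h x = bump h (toℕ x)

Small : ∀ {m} → ℕ → Fin m → Set
Small h x = toℕ x ≤ h

weight-progression : ∀ h (x d : Fin (h + h)) → let y = x +ₘ d; z = y +ₘ d in
  Small h x → Small h y → Small h z →
  4 * weight h y ≡ 2 * weight h x + 2 * weight h z + ∣ toℕ x - toℕ z ∣ * ∣ toℕ x - toℕ z ∣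
weight-progression h x d x≤h y≤h z≤h =
  let e  , eq  = +ₘ-quotient x d
      e′ , eq′ = +ₘ-quotient (x +ₘ d) d
  -- The two carries give x + d = y + 2he and y + d = z + 2he′. Adding them crosswise and cancelling
  -- d leaves a relation between x, y and z alone.
  in bump-mod h e e′ x≤h y≤h z≤h (+-cancelʳ-≡ (toℕ d) _ _ (begin-equality
    toℕ x + c + e′ * (h + h) + toℕ d     ≡⟨ rotate (toℕ x) c (e′ * (h + h)) (toℕ d) ⟩
    toℕ x + toℕ d + (c + e′ * (h + h))   ≡⟨ cong₂ _+_ eq (sym eq′) ⟩
    b + e * (h + h) + (b + toℕ d)        ≡⟨ rotate′ b (e * (h + h)) (toℕ d) ⟩
    b + b + e * (h + h) + toℕ d          ∎))
  where
  b = toℕ (x +ₘ d)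
  c = toℕ ((x +ₘ d) +ₘ d)
  rotate : ∀ x c e d → x + c + e + d ≡ x + d + (c + e)
  rotate = solve-∀
  rotate′ : ∀ b e d → b + e + (b + d) ≡ b + b + e + d
  rotate′ = solve-∀

dist² : ∀ {m n} → Vec (Fin m) n → Vec (Fin m) n → ℕ
dist² []       []       = 0
dist² (x ∷ xs) (y ∷ ys) = ∣ toℕ x - toℕ y ∣ * ∣ toℕ x - toℕ y ∣ + dist² xs ys

dist²≡0⇒≡ : ∀ {m n} (xs ys : Vec (Fin m) n) → dist² xs ys ≡ 0 → xs ≡ ys
dist²≡0⇒≡ []       []       _ = refl
dist²≡0⇒≡ (x ∷ xs) (y ∷ ys) e = cong₂ _∷_
  (toℕ-injective (∣m-n∣≡0⇒m≡n (m*m≡0⇒m≡0 ∣ toℕ x - toℕ y ∣ (m+n≡0⇒m≡0 _ e))))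
  (dist²≡0⇒≡ xs ys (m+n≡0⇒n≡0 (∣ toℕ x - toℕ y ∣ * ∣ toℕ x - toℕ y ∣) e))
  where
  m*m≡0⇒m≡0 : ∀ m → m * m ≡ 0 → m ≡ 0
  m*m≡0⇒m≡0 zero _ = refl

total-progression : ∀ {n} h (x d : Vec (Fin (h + h)) n) → let y = x ⊕ d; z = y ⊕ d in
  All (Small h) x → All (Small h) y → All (Small h) z →
  4 * total (weight h) y ≡ 2 * total (weight h) x + 2 * total (weight h) z + dist² x z
total-progression h []       []       []         []         []         = refl
total-progression h (x ∷ xs) (d ∷ ds) (px ∷ pxs) (py ∷ pys) (pz ∷ pzs) =
  let y = x +ₘ d; z = y +ₘ d; w = weight h; t = total w
      zs = (xs ⊕ ds) ⊕ ds; δ = ∣ toℕ x - toℕ z ∣ * ∣ toℕ x - toℕ z ∣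
  in begin-equality
  4 * (w y + t (xs ⊕ ds))
    ≡⟨ *-distribˡ-+ 4 (w y) (t (xs ⊕ ds)) ⟩
  4 * w y + 4 * t (xs ⊕ ds)
    ≡⟨ cong₂ _+_ (weight-progression h x d px py pz) (total-progression h xs ds pxs pys pzs) ⟩
  2 * w x + 2 * w z + δ + (2 * t xs + 2 * t zs + dist² xs zs)
    ≡⟨ regroup (w x) (w z) δ (t xs) (t zs) (dist² xs zs) ⟩
  2 * (w x + t xs) + 2 * (w z + t zs) + (δ + dist² xs zs) ∎
  where
  regroup : ∀ a b c a′ b′ c′ → 2 * a + 2 * b + c + (2 * a′ + 2 * b′ + c′)
                               ≡ 2 * (a + a′) + 2 * (b + b′) + (c + c′)
  regroup = solve-∀

-- Level sets as progression-free sets, and the bound on `r 3`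

fromList-unique : {xs : List A} → Uniqueˡ xs → Unique (fromList xs)
fromList-unique []       = []
fromList-unique (p ∷ ps) = All.fromList⁺ p ∷ fromList-unique ps

-- On the level v the identity of `total-progression` reads 4v = 2v + 2v + `dist²`, so the distance
-- vanishes and positions 0 and 2 coincide, against injectivity.
level-set-free : ∀ {n} h v (xs : List (Vec (Fin (h + h)) n)) →
  (∀ {x} → x ∈ˡ xs → All (Small h) x × total (weight h) x ≡ v) →
  ¬ ContainsProperAP 3 (fromList xs)
level-set-free h v xs level (x , d , inj , x∈) =
  contradiction (inj {zero} {suc (suc zero)} (dist²≡0⇒≡ x _ dist≡0)) λ ()
  where
  t = λ i → level (∈-fromList⁻ (x∈ i))
  dist≡0 : dist² x ((x ⊕ d) ⊕ d) ≡ 0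
  dist≡0 = +-cancelˡ-≡ (2 * v + 2 * v) _ _ (begin-equality
    2 * v + 2 * v + dist² x ((x ⊕ d) ⊕ d)
      ≡⟨ cong₂ (λ a b → 2 * a + 2 * b + dist² x ((x ⊕ d) ⊕ d))
           (proj₂ (t zero)) (proj₂ (t (suc (suc zero)))) ⟨
    2 * total (weight h) x + 2 * total (weight h) ((x ⊕ d) ⊕ d) + dist² x ((x ⊕ d) ⊕ d)
      ≡⟨ total-progression h x d (proj₁ (t zero)) (proj₁ (t (suc zero))) (proj₁ (t (suc (suc zero)))) ⟨
    4 * total (weight h) (x ⊕ d)
      ≡⟨ cong (4 *_) (proj₂ (t (suc zero))) ⟩
    4 * v
      ≡⟨ *-distribʳ-+ v 2 2 ⟩
    2 * v + 2 * v
      ≡⟨ +-identityʳ (2 * v + 2 * v) ⟨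
    2 * v + 2 * v + 0 ∎)

module _ (g : ℕ) .{{_ : NonZero g}} where

  private h = suc g

  1+h≤2h : suc h ≤ h + h
  1+h≤2h = +-monoˡ-≤ h (s≤s z≤n)

  digits : List (Fin (h + h))
  digits = tabulate {n = suc h} (λ i → inject≤ i 1+h≤2h)

  length-digits : length digits ≡ suc h
  length-digits = length-tabulate {n = suc h} (λ i → inject≤ i 1+h≤2h)

  digits-unique : Uniqueˡ digits
  digits-unique = Uniqueˡ.tabulate⁺ (λ {i} {j} → inject≤-injective 1+h≤2h 1+h≤2h i j)

  digits-small : ∀ {x} → x ∈ˡ digits → Small h x
  digits-small x∈ with ∈-tabulate⁻ {f = λ i → inject≤ i 1+h≤2h} x∈
  ... | i , refl = subst (_≤ h) (sym (toℕ-inject≤ i 1+h≤2h)) (≤-pred (toℕ<n i))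

  fibre≤r : ∀ n v → ∑ (cube digits n) (λ x → 𝟙 (total (weight h) x ≟ v)) ≤ r 3 (h + h) n
  fibre≤r n v = subst (_≤ r 3 (h + h) n) (length-filter≡∑𝟙 level? (cube digits n))
    (proj₂ (proj₂ (maxAPFree 3 (h + h) n)) _
      ( fromList (filter level? (cube digits n))
      , fromList-unique (Uniqueˡ.filter⁺ level? (cube-unique digits-unique n))
      , level-set-free h v _ (λ x∈ →
          let x∈cube , eq = ∈-filter⁻ level? {xs = cube digits n} x∈
          in ∈-cube⁻ digits-small x∈cube , eq)))
    where
    level? : Decidable (λ (x : Vec (Fin (h + h)) n) → total (weight h) x ≡ v)
    level? x = total (weight h) x ≟ v

  -- This is N² ≤ (1 + 24nσ²) M² times 15, with σ² = P / 180. After `dispersion` is multiplied by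
  -- 180, `variance` replaces 180NA₂, the terms in A₁² cancel, and 12N² is divided out.
  fourth-power-bound : ∀ n → let M = r 3 (h + h) n; N = suc h ^ n in
    15 * (N * N) ≤ 15 * (M * M) + 2 * (M * M) * n * 180σ² g
  fourth-power-bound n = *-cancelˡ-≤ (12 * (N * N)) (begin
    12 * (N * N) * (15 * (N * N))
      ≡⟨ regroup₁ N ⟩
    180 * (N * N * (N * N))
      ≤⟨ +-cancelʳ-≤ (24 * (M * M) * (180 * (A₁ * A₁))) _ _ (begin
        180 * (N * N * (N * N)) + 24 * (M * M) * (180 * (A₁ * A₁))
          ≡⟨ regroup₂ N M A₁ ⟩
        180 * (N * N * (N * N) + 24 * (M * M) * (A₁ * A₁))
          ≤⟨ *-monoʳ-≤ 180 bound ⟩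
        180 * (N * N * (M * M) + 24 * (M * M) * (N * A₂))
          ≡⟨ regroup₃ N M A₂ ⟩
        180 * (N * N) * (M * M) + 24 * (M * M) * (180 * (N * A₂))
          ≡⟨ cong (λ u → 180 * (N * N) * (M * M) + 24 * (M * M) * u) variance ⟨
        180 * (N * N) * (M * M) + 24 * (M * M) * (180 * (A₁ * A₁) + n * (N * N) * P)
          ≡⟨ regroup₄ N M A₁ n P ⟩
        12 * (N * N) * (15 * (M * M) + 2 * (M * M) * n * P) + 24 * (M * M) * (180 * (A₁ * A₁)) ∎) ⟩
    12 * (N * N) * (15 * (M * M) + 2 * (M * M) * n * P) ∎)
    where
    open Moments digits (weight h) renaming (A₁ to A₁′; A₂ to A₂′)
    M = r 3 (h + h) n
    N = suc h ^ n
    P = 180σ² g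
    A₁ = A₁′ n
    A₂ = A₂′ n
    instance
      M≢0 : NonZero M
      M≢0 = r₃≢0 (h + h) n
      N≢0 : NonZero N
      N≢0 = m^n≢0 (suc h) n
      NN≢0 : NonZero (N * N)
      NN≢0 = m*n≢0 N N
      12NN≢0 : NonZero (12 * (N * N))
      12NN≢0 = m*n≢0 12 (N * N)

    N≡ : length (cube digits n) ≡ N
    N≡ = trans (length-cube digits n) (cong (_^ n) length-digits)

    bound : N * N * (N * N) + 24 * (M * M) * (A₁ * A₁) ≤ N * N * (M * M) + 24 * (M * M) * (N * A₂)
    bound = subst (λ N → N * N * (N * N) + 24 * (M * M) * (A₁ * A₁) ≤
                         N * N * (M * M) + 24 * (M * M) * (N * A₂)) N≡
      (dispersion (length (cube digits n)) M A₁ A₂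
        (Spread.pair-spread (cube digits n) (total (weight h)) M (fibre≤r n)))

    base : 180 * (∑ digits (weight h) * ∑ digits (weight h)) + length digits * length digits * P
           ≡ 180 * (length digits * ∑ digits (λ x → weight h x * weight h x))
    base = begin-equality
      180 * (∑ digits (weight h) * ∑ digits (weight h)) + length digits * length digits * P
        ≡⟨ cong₂ (λ s k → 180 * (s * s) + k * k * P) s₁ length-digits ⟩
      180 * (S₁ * S₁) + suc h * suc h * P
        ≡⟨ Digits.variance g ⟩
      180 * (suc h * S₂)
        ≡⟨ cong₂ (λ k s → 180 * (k * s)) length-digits s₂ ⟨
      180 * (length digits * ∑ digits (λ x → weight h x * weight h x)) ∎
      where
      open Digits g using (S₁; S₂)
      s₁ : ∑ digits (weight h) ≡ S₁
      s₁ = ∑-tabulate (λ i → inject≤ i 1+h≤2h) (weight h) (bump h)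
             (λ i → cong (bump h) (toℕ-inject≤ i 1+h≤2h))
      s₂ : ∑ digits (λ x → weight h x * weight h x) ≡ S₂
      s₂ = ∑-tabulate (λ i → inject≤ i 1+h≤2h)
             (λ x → weight h x * weight h x) (λ x → bump h x * bump h x)
             (λ i → cong (λ u → bump h u * bump h u) (toℕ-inject≤ i 1+h≤2h))

    variance : 180 * (A₁ * A₁) + n * (N * N) * P ≡ 180 * (N * A₂)
    variance = subst (λ N → 180 * (A₁ * A₁) + n * (N * N) * P ≡ 180 * (N * A₂)) N≡
      (variance-cube 180 P base n)

    regroup₁ : ∀ N → 12 * (N * N) * (15 * (N * N)) ≡ 180 * (N * N * (N * N))
    regroup₁ = solve-∀
    regroup₂ : ∀ N M A → 180 * (N * N * (N * N)) + 24 * (M * M) * (180 * (A * A))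
                         ≡ 180 * (N * N * (N * N) + 24 * (M * M) * (A * A))
    regroup₂ = solve-∀
    regroup₃ : ∀ N M A → 180 * (N * N * (M * M) + 24 * (M * M) * (N * A))
                         ≡ 180 * (N * N) * (M * M) + 24 * (M * M) * (180 * (N * A))
    regroup₃ = solve-∀
    regroup₄ : ∀ N M A n P →
      180 * (N * N) * (M * M) + 24 * (M * M) * (180 * (A * A) + n * (N * N) * P)
      ≡ 12 * (N * N) * (15 * (M * M) + 2 * (M * M) * n * P) + 24 * (M * M) * (180 * (A * A))
    regroup₄ = solve-∀

  -- The target is N² ≤ 27nσ²M², as 27 / 180 = 3 / 20. The lone M² must fit into the gap between 24
  -- and 27, which asks for 3nσ² ≥ 1; this is the premise 60 ≤ nP of `generic`.
  square-bound : ∀ n .{{_ : NonZero n}} → let M = r 3 (h + h) n; N = suc h ^ n in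
    20 * (N * N) ≤ 3 * n * 180σ² g * (M * M)
  square-bound n = numeric n g (r 3 (h + h) n) (fourth-power-bound n)
    where
    generic : ∀ N M n P → 60 ≤ n * P → 15 * (N * N) ≤ 15 * (M * M) + 2 * (M * M) * n * P →
              20 * (N * N) ≤ 3 * n * P * (M * M)
    generic N M n P 60≤ le = *-cancelˡ-≤ 3 (begin
      3 * (20 * (N * N))                            ≡⟨ regroup₁ (N * N) ⟩
      4 * (15 * (N * N))                            ≤⟨ *-monoʳ-≤ 4 le ⟩
      4 * (15 * (M * M) + 2 * (M * M) * n * P)      ≡⟨ regroup₂ (M * M) n P ⟩
      M * M * 60 + 8 * (M * M) * (n * P)            ≤⟨ +-monoˡ-≤ _ (*-monoʳ-≤ (M * M) 60≤) ⟩
      M * M * (n * P) + 8 * (M * M) * (n * P)       ≡⟨ regroup₃ (M * M) n P ⟩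
      3 * (3 * n * P * (M * M))                     ∎)
      where
      regroup₁ : ∀ x → 3 * (20 * x) ≡ 4 * (15 * x)
      regroup₁ = solve-∀
      regroup₂ : ∀ x n P → 4 * (15 * x + 2 * x * n * P) ≡ x * 60 + 8 * x * (n * P)
      regroup₂ = solve-∀
      regroup₃ : ∀ x n P → x * (n * P) + 8 * x * (n * P) ≡ 3 * (3 * n * P * x)
      regroup₃ = solve-∀

    -- For h = 2 and n = 1 the bound 9 ≤ (19/3) M² only suffices because M is an integer.
    small : ∀ M → 15 * 9 ≤ 15 * (M * M) + 2 * (M * M) * 1 * 40 → 20 * 9 ≤ 3 * 1 * 40 * (M * M)
    small 0 ()
    small 1 le = contradiction le (<⇒≱ (m≤m+n 96 39))
    small (suc (suc M)) _ = ≤-trans (m≤m+n 180 300)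
      (*-monoʳ-≤ 120 (*-mono-≤ {2} {suc (suc M)} (s≤s (s≤s z≤n)) (s≤s (s≤s z≤n))))

    -- For g = 1 one has P = 40, so n ≥ 2 already gives nP ≥ 80. For g ≥ 2 the factors of P are at
    -- least 2, 3, 5 and 6, so P ≥ 180 suffices for every n.
    numeric : ∀ n g .{{_ : NonZero n}} .{{_ : NonZero g}} M → let N = suc (suc g) ^ n in
      15 * (N * N) ≤ 15 * (M * M) + 2 * (M * M) * n * 180σ² g →
      20 * (N * N) ≤ 3 * n * 180σ² g * (M * M)
    numeric 1             1             M = small M
    numeric (suc (suc n)) 1             M =
      generic (3 ^ suc (suc n)) M (suc (suc n)) 40
        (≤-trans (m≤m+n 60 20) (*-monoˡ-≤ 40 {2} {suc (suc n)} (s≤s (s≤s z≤n))))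
    numeric (suc n)       (suc (suc g)) M =
      generic (suc (suc (suc (suc g))) ^ suc n) M (suc n) (180σ² (suc (suc g)))
        (≤-trans (m≤m+n 60 120) (*-mono-≤ {1} {suc n} {180} {180σ² (suc (suc g))} (s≤s z≤n) 180≤))
      where
      180≤ : 180 ≤ 180σ² (suc (suc g))
      180≤ = *-mono-≤ (*-mono-≤ (*-mono-≤ (m≤m+n 2 g) (m≤m+n 3 g)) (m≤m+n 5 g)) (m≤m+n 6 g)

-- Comparing reals whose squares are rational

ι : ℕ → ℚ
ι n = ℤ.+ n ℚ./ 1

ι≃ : ∀ n → ℚ.toℚᵘ (ι n) ℚᵘ.≃ ℚᵘ.mkℚᵘ (ℤ.+ n) 0
ι≃ n = ℚ.toℚᵘ-fromℚᵘ (ℚᵘ.mkℚᵘ (ℤ.+ n) 0)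

ι-+ : ∀ a b → ι (a + b) ≡ ι a ℚ.+ ι b
ι-+ a b = ℚ.toℚᵘ-injective (ℚᵘ.≃-trans (ι≃ (a + b)) (ℚᵘ.≃-trans
  (ℚᵘ.*≡* (cong (ℤ._* ℤ.+ 1) (trans (ℤ.pos-+ a b)
    (sym (cong₂ ℤ._+_ (ℤ.*-identityʳ (ℤ.+ a)) (ℤ.*-identityʳ (ℤ.+ b)))))))
  (ℚᵘ.≃-sym (ℚᵘ.≃-trans (ℚ.toℚᵘ-homo-+ (ι a) (ι b)) (ℚᵘ.+-cong (ι≃ a) (ι≃ b))))))

ι-* : ∀ a b → ι (a * b) ≡ ι a ℚ.* ι b
ι-* a b = ℚ.toℚᵘ-injective (ℚᵘ.≃-trans (ι≃ (a * b)) (ℚᵘ.≃-trans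
  (ℚᵘ.*≡* (cong (ℤ._* ℤ.+ 1) (ℤ.pos-* a b)))
  (ℚᵘ.≃-sym (ℚᵘ.≃-trans (ℚ.toℚᵘ-homo-* (ι a) (ι b)) (ℚᵘ.*-cong (ι≃ a) (ι≃ b))))))

ι-mono-≤ : ∀ {a b} → a ≤ b → ι a ℚ.≤ ι b
ι-mono-≤ {a} {b} a≤b = ℚ.toℚᵘ-cancel-≤ (ℚᵘ.≤-trans (ℚᵘ.≤-reflexive (ι≃ a))
  (ℚᵘ.≤-trans (ℚᵘ.*≤* (ℤ.*-monoʳ-≤-nonNeg (ℤ.+ 1) (ℤ.+≤+ a≤b)))
    (ℚᵘ.≤-reflexive (ℚᵘ.≃-sym (ι≃ b)))))

ι-pos : ∀ n .{{_ : NonZero n}} → 0ℚ ℚ.< ι n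
ι-pos n = ℚ.positive⁻¹ (ι n) {{ℚ.normalize-pos n 1}}

steps≡ι : ∀ k → CutLemmas.steps k ≡ ι k
steps≡ι zero    = refl
steps≡ι (suc k) = trans (cong (1ℚ ℚ.+_) (steps≡ι k)) (sym (ι-+ 1 k))

open CutLemmas using (pos*; monoˡ; monoʳ; mono*; inv; √-above; √-below; archimedean)
open +-*-Solver using (solve; _:*_; _:+_; _:-_; con; _:=_)

cancelʳ : ∀ {p q r} → 0ℚ ℚ.< r → p ℚ.* r ℚ.< q ℚ.* r → p ℚ.< q
cancelʳ {r = r} 0<r = ℚ.*-cancelʳ-<-nonNeg r {{ℚ.pos⇒nonNeg r {{ℚ.positive 0<r}}}}

cancel-reciprocal : ∀ q u s → q ℚ.* u ≡ 1ℚ → q ℚ.* q ℚ.* (u ℚ.* u ℚ.* s) ≡ s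
cancel-reciprocal q u s e = trans
  (solve 3 (λ q u s → q :* q :* (u :* u :* s) := (q :* u) :* ((q :* u) :* s)) refl q u s)
  (trans (cong (λ w → w ℚ.* (w ℚ.* s)) e)
    (trans (ℚ.*-identityˡ (1ℚ ℚ.* s)) (ℚ.*-identityˡ s)))

cancel-square : ∀ {p q} → 0ℚ ℚ.< p → 0ℚ ℚ.< q → p ℚ.* p ℚ.< q ℚ.* q → p ℚ.< q
cancel-square {p} {q} 0<p 0<q pp<qq with p ℚ.<? q
... | yes p<q = p<q
... | no  p≮q = contradiction (ℚ.<-≤-trans pp<qq (ℚ.≤-trans
  (ℚ.*-monoˡ-≤-nonNeg q {{ℚ.pos⇒nonNeg q {{ℚ.positive 0<q}}}} (ℚ.≮⇒≥ p≮q))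
  (ℚ.*-monoʳ-≤-nonNeg p {{ℚ.pos⇒nonNeg p {{ℚ.positive 0<p}}}} (ℚ.≮⇒≥ p≮q)))) (ℚ.<-irrefl refl)

-- x² = p / d for the real number with the cut (L , U).  Every real number in the theorem
-- is the square root of a rational, so comparing them comes down to comparing naturals.
record CutSquareIs (L U : ℚ → Set) (p d : ℕ) : Set where
  field
    0<p   : 0ℚ ℚ.< ι p
    0<d   : 0ℚ ℚ.< ι d
    lower : ∀ {q} → L q → q ℚ.* q ℚ.* ι d ℚ.< ι p
    upper : ∀ {q} → U q → ι p ℚ.< q ℚ.* q ℚ.* ι d

  p/d : ∃[ s ] 0ℚ ℚ.< s × s ℚ.* ι d ≡ ι p
  p/d = let u , 0<u , e = inv 0<d in
    ι p ℚ.* u , pos* 0<p 0<u ,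
    trans (ℚ.*-assoc (ι p) u (ι d))
      (trans (cong (ι p ℚ.*_) (trans (ℚ.*-comm u (ι d)) e)) (ℚ.*-identityʳ (ι p)))

open CutSquareIs

-- The index is the cut and not the record ℝ⁺, as conversion between two reals would
-- compare the proofs they contain.
SquareIs : ℝ⁺ → ℕ → ℕ → Set
SquareIs x = CutSquareIs (ℝ⁺.L x) (ℝ⁺.U x)

private variable
  p d p′ d′ : ℕ

-- Here locatedness of the cut is essential. Pick h > q with h² still below p / d; then either q
-- lies in the lower cut or h lies in the upper one, and the latter contradicts `upper`.
lower⁻ : ∀ x → SquareIs x p d → ∀ {q} → 0ℚ ℚ.< q → q ℚ.* q ℚ.* ι d ℚ.< ι p → ℝ⁺.L x q
lower⁻ {p} {d} x sx {q} 0<q lt =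
  let s , 0<s , e    = p/d sx
      h , q<h , hh<s = √-above 0<q 0<s
        (cancelʳ (0<d sx) (subst (q ℚ.* q ℚ.* ι d ℚ.<_) (sym e) lt))
  in fromInj₁ (λ h∈U → contradiction (upper sx h∈U)
       (ℚ.<-asym (subst (h ℚ.* h ℚ.* ι d ℚ.<_) e (monoˡ (0<d sx) hh<s))))
       (ℝ⁺.located x 0<q q<h)

upper⁻ : ∀ x → SquareIs x p d → ∀ {q} → 0ℚ ℚ.< q → ι p ℚ.< q ℚ.* q ℚ.* ι d → ℝ⁺.U x q
upper⁻ {p} {d} x sx {q} 0<q lt =
  let s , 0<s , e          = p/d sx
      h , 0<h , h<q , s<hh = √-below 0<s 0<q
        (cancelʳ (0<d sx) (subst (ℚ._< q ℚ.* q ℚ.* ι d) (sym e) lt))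
  in fromInj₂ (λ h∈L → contradiction (lower sx h∈L)
       (ℚ.<-asym (subst (ℚ._< h ℚ.* h ℚ.* ι d) e (monoˡ (0<d sx) s<hh))))
       (ℝ⁺.located x 0<h h<q)

square-≤ : ∀ x y → SquareIs x p d → SquareIs y p′ d′ → p * d′ ≤ p′ * d → x ≤ᴿ y
square-≤ {p} {d} {p′} {d′} x y sx sy le q q∈ =
  lower⁻ y sy (ℝ⁺.L-pos x q∈) (cancelʳ (0<d sx) (ℚ.<-≤-trans
    (subst₂ ℚ._<_ (swap (q ℚ.* q) (ι d) (ι d′)) (sym (ι-* p d′)) (monoˡ (0<d sy) (lower sx q∈)))
    (ℚ.≤-trans (ι-mono-≤ le) (ℚ.≤-reflexive (ι-* p′ d)))))
  where
  swap : ∀ a b c → a ℚ.* b ℚ.* c ≡ a ℚ.* c ℚ.* b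
  swap = solve 3 (λ a b c → a :* b :* c := a :* c :* b) refl

square-ℕ : ∀ n .{{_ : NonZero n}} → SquareIs (fromℕ n) (n * n) 1
square-ℕ n = record
  { 0<p   = subst (0ℚ ℚ.<_) (sym (ι-* n n)) (pos* (ι-pos n) (ι-pos n))
  ; 0<d   = ι-pos 1
  ; lower = λ {q} (0<q , q<n) → subst₂ ℚ._<_ (sym (ℚ.*-identityʳ (q ℚ.* q))) (sym (ι-* n n))
              (mono* 0<q (ι-pos n) q<n q<n)
  ; upper = λ {q} n<q → subst₂ ℚ._<_ (sym (ι-* n n)) (sym (ℚ.*-identityʳ (q ℚ.* q)))
              (mono* (ι-pos n) (ℚ.<-trans (ι-pos n) n<q) n<q n<q)
  }

square-* : ∀ x y → SquareIs x p d → SquareIs y p′ d′ → SquareIs (x *ᴿ y) (p * p′) (d * d′)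
square-* {p} {d} {p′} {d′} x y sx sy = record
  { 0<p   = subst (0ℚ ℚ.<_) (sym (ι-* p p′)) (pos* (0<p sx) (0<p sy))
  ; 0<d   = 0<dd′
  ; lower = λ {q} (0<q , a , b , a∈ , b∈ , q<ab) →
      let 0<a = ℝ⁺.L-pos x a∈ ; 0<b = ℝ⁺.L-pos y b∈ in
      ℚ.<-trans (monoˡ 0<dd′ (mono* 0<q (pos* 0<a 0<b) q<ab q<ab))
        (subst₂ ℚ._<_ (sym (regroup a b)) (sym (ι-* p p′))
          (mono* (pos* (pos* 0<a 0<a) (0<d sx)) (0<p sy) (lower sx a∈) (lower sy b∈)))
  ; upper = λ {q} (a , b , a∈ , b∈ , ab<q) →
      let 0<a = ℝ⁺.U-pos x a∈ ; 0<b = ℝ⁺.U-pos y b∈ ; 0<ab = pos* 0<a 0<b in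
      ℚ.<-trans
        (subst₂ ℚ._<_ (sym (ι-* p p′)) (sym (regroup a b))
          (mono* (0<p sx) (pos* (pos* 0<b 0<b) (0<d sy)) (upper sx a∈) (upper sy b∈)))
        (monoˡ 0<dd′ (mono* 0<ab (ℚ.<-trans 0<ab ab<q) ab<q ab<q))
  }
  where
  0<dd′ : 0ℚ ℚ.< ι (d * d′)
  0<dd′ = subst (0ℚ ℚ.<_) (sym (ι-* d d′)) (pos* (0<d sx) (0<d sy))
  regroup : ∀ a b → (a ℚ.* b) ℚ.* (a ℚ.* b) ℚ.* ι (d * d′) ≡ (a ℚ.* a ℚ.* ι d) ℚ.* (b ℚ.* b ℚ.* ι d′)
  regroup a b = trans (cong ((a ℚ.* b) ℚ.* (a ℚ.* b) ℚ.*_) (ι-* d d′))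
    (solve 4 (λ a b c d → (a :* b) :* (a :* b) :* (c :* d) := (a :* a :* c) :* (b :* b :* d))
      refl a b (ι d) (ι d′))

square-⁻¹ : ∀ x → SquareIs x p d → SquareIs (x ⁻¹) d p
square-⁻¹ {p} {d} x sx = record
  { 0<p   = 0<d sx
  ; 0<d   = 0<p sx
  ; lower = λ {q} q∈ → lo {q} (ℝ⁺.L-pos (x ⁻¹) q∈) (proj₁ (proj₂ q∈)) (proj₂ (proj₂ q∈))
  ; upper = λ {q} q∈ → up {q} (ℝ⁺.U-pos (x ⁻¹) q∈) (proj₁ (proj₂ q∈)) (proj₂ (proj₂ q∈))
  }
  where
  lo : ∀ {q u} → 0ℚ ℚ.< q → q ℚ.* u ≡ 1ℚ → ℝ⁺.U x u → q ℚ.* q ℚ.* ι p ℚ.< ι d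
  lo {q} {u} 0<q e u∈ = subst (q ℚ.* q ℚ.* ι p ℚ.<_) (cancel-reciprocal q u (ι d) e)
    (monoʳ (pos* 0<q 0<q) (upper sx u∈))
  up : ∀ {q u} → 0ℚ ℚ.< q → q ℚ.* u ≡ 1ℚ → ℝ⁺.L x u → ι d ℚ.< q ℚ.* q ℚ.* ι p
  up {q} {u} 0<q e u∈ = subst (ℚ._< q ℚ.* q ℚ.* ι p) (cancel-reciprocal q u (ι d) e)
    (monoʳ (pos* 0<q 0<q) (lower sx u∈))

square-÷ : ∀ x y → SquareIs x p d → SquareIs y p′ d′ → SquareIs (x ÷ y) (p * d′) (d * p′)
square-÷ x y sx sy = square-* x (y ⁻¹) sx (square-⁻¹ y sy)

-- If x² = (p / d)² then x = p / d is itself the square of its root. Perfect squares suffice because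
-- every radicand in the theorem is rational.
square-√ : ∀ x p d .{{_ : NonZero p}} .{{_ : NonZero d}} →
           SquareIs x (p * p) (d * d) → SquareIs (√ x) p d
square-√ x p d sx = record
  { 0<p   = ι-pos p
  ; 0<d   = ι-pos d
  ; lower = λ {q} (0<q , q²∈) → cancel-square (pos* (pos* 0<q 0<q) (ι-pos d)) (ι-pos p)
      (subst₂ ℚ._<_ (regroup q) (ι-* p p) (lower sx q²∈))
  ; upper = λ {q} (0<q , q²∈) → cancel-square (ι-pos p) (pos* (pos* 0<q 0<q) (ι-pos d))
      (subst₂ ℚ._<_ (ι-* p p) (regroup q) (upper sx q²∈))
  }
  where
  regroup : ∀ q → q ℚ.* q ℚ.* (q ℚ.* q) ℚ.* ι (d * d) ≡ (q ℚ.* q ℚ.* ι d) ℚ.* (q ℚ.* q ℚ.* ι d)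
  regroup q = trans (cong (q ℚ.* q ℚ.* (q ℚ.* q) ℚ.*_) (ι-* d d))
    (solve 2 (λ q d → q :* q :* (q :* q) :* (d :* d) := (q :* q :* d) :* (q :* q :* d)) refl q (ι d))

square-√ℕ : ∀ n .{{_ : NonZero n}} → SquareIs (√ fromℕ n) n 1
square-√ℕ n = square-√ (fromℕ n) n 1 (square-ℕ n)

square-^ : ∀ x → SquareIs x p d → ∀ n → SquareIs (x ^ᴿ n) (p ^ n) (d ^ n)
square-^ x sx zero    = square-ℕ 1
square-^ x sx (suc n) = square-* x (x ^ᴿ n) sx (square-^ x sx n)

-- Squares of the constants and the lower bound

square-σ : ∀ m (m≥4 : 4 ≤ m) → SquareIs (σ m m≥4) (2880σ² m) 2880
square-σ m m≥4 = square-√ (fromℕ s ÷ fromℕ 2880) s 2880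
  (subst (λ p → SquareIs (fromℕ s ÷ fromℕ 2880) p (2880 * 2880)) (*-identityʳ (s * s))
    (square-÷ (fromℕ s) (fromℕ 2880) (square-ℕ s) (square-ℕ 2880)))
  where
  s = 2880σ² m
  instance _ = 2880σ²≢0 m m≥4

square-C : ∀ m (m≥4 : 4 ≤ m) → SquareIs (C m m≥4) 2880 (27 * 2880σ² m)
square-C m m≥4 = subst (SquareIs (C m m≥4) 2880) (*-identityˡ (27 * 2880σ² m))
  (square-÷ (fromℕ 1) (fromℕ 3 *ᴿ √ fromℕ 3 *ᴿ σ m m≥4) (square-ℕ 1)
    (square-* (fromℕ 3 *ᴿ √ fromℕ 3) (σ m m≥4)
      (square-* (fromℕ 3) (√ fromℕ 3) (square-ℕ 3) (square-√ℕ 3))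
      (square-σ m m≥4)))

-- The polynomial factors as m (m - 2) (m + 4) (m + 6); at m = 2 (1 + g) each factor is twice a
-- factor of `180σ² g`.
2880σ²-even : ∀ g → let h = suc g in 2880σ² (h + h) ≡ 16 * 180σ² g
2880σ²-even g = trans (cong (_∸ 48 * (suc g + suc g)) (identity g))
  (m+n∸n≡m (16 * 180σ² g) (48 * (suc g + suc g)))
  where
  identity : ∀ g → let m = suc g + suc g in
    m * (m * (m * (m * 1))) + 8 * (m * (m * (m * 1))) + 4 * (m * (m * 1))
    ≡ 16 * (g * (1 + g) * (3 + g) * (4 + g)) + 48 * m
  identity = solve-∀

even≥4 : ∀ {m} → 4 ≤ m → 2 ∣ m → ∃[ g ] m ≡ suc (suc g) + suc (suc g)
even≥4 (s≤s (s≤s ())) (divides 1 refl)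
even≥4 _              (divides (suc (suc g)) refl) = g , double (suc (suc g))
  where
  double : ∀ k → k * 2 ≡ k + k
  double = solve-∀

^-distribʳ-* : ∀ n a b → (a * b) ^ n ≡ a ^ n * b ^ n
^-distribʳ-* zero    a b = refl
^-distribʳ-* (suc n) a b =
  trans (cong (a * b *_) (^-distribʳ-* n a b)) ([m*n]*[o*p]≡[m*o]*[n*p] a b (a ^ n) (b ^ n))

square-lhs : ∀ m (m≥4 : 4 ≤ m) n .{{_ : NonZero n}} →
  SquareIs (C m m≥4 ÷ √ fromℕ n *ᴿ (fromℕ (2 + m) ÷ fromℕ 2) ^ᴿ n)
    (2880 * 1 * ((2 + m) * (2 + m) * 1) ^ n) (27 * 2880σ² m * n * 4 ^ n)
square-lhs m m≥4 n = square-* (C m m≥4 ÷ √ fromℕ n) ((fromℕ (2 + m) ÷ fromℕ 2) ^ᴿ n)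
  (square-÷ (C m m≥4) (√ fromℕ n) (square-C m m≥4) (square-√ℕ n))
  (square-^ (fromℕ (2 + m) ÷ fromℕ 2)
    (square-÷ (fromℕ (2 + m)) (fromℕ 2) (square-ℕ (2 + m)) (square-ℕ 2)) n)

-- The premise multiplied by 144 · 4ⁿ: here 2880 = 144 · 20 and 27 · 16 = 144 · 3, and 4ⁿ comes from
-- (m + 2)² = 4 (h + 1)².
cleared-bound : ∀ g n M → let h = suc g; m = h + h; N = suc h ^ n in
  20 * (N * N) ≤ 3 * n * 180σ² g * (M * M) →
  2880 * 1 * ((2 + m) * (2 + m) * 1) ^ n * 1 ≤ M * M * (27 * 2880σ² m * n * 4 ^ n)
cleared-bound g n M le = begin
  2880 * 1 * ((2 + m) * (2 + m) * 1) ^ n * 1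
    ≡⟨ cong (λ u → 2880 * 1 * u * 1) power ⟩
  2880 * 1 * (4 ^ n * (N * N)) * 1
    ≡⟨ regroup₁ (4 ^ n) (N * N) ⟩
  144 * 4 ^ n * (20 * (N * N))
    ≤⟨ *-monoʳ-≤ (144 * 4 ^ n) le ⟩
  144 * 4 ^ n * (3 * n * P * (M * M))
    ≡⟨ regroup₂ (4 ^ n) n P M ⟩
  M * M * (27 * (16 * P) * n * 4 ^ n)
    ≡⟨ cong (λ u → M * M * (27 * u * n * 4 ^ n)) (2880σ²-even g) ⟨
  M * M * (27 * 2880σ² m * n * 4 ^ n) ∎
  where
  h = suc g
  m = h + h
  N = suc h ^ n
  P = 180σ² g
  factor : ∀ h → (2 + (h + h)) * (2 + (h + h)) * 1 ≡ 4 * (suc h * suc h)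
  factor = solve-∀
  power : ((2 + m) * (2 + m) * 1) ^ n ≡ 4 ^ n * (N * N)
  power = begin-equality
    ((2 + m) * (2 + m) * 1) ^ n       ≡⟨ cong (_^ n) (factor h) ⟩
    (4 * (suc h * suc h)) ^ n         ≡⟨ ^-distribʳ-* n 4 (suc h * suc h) ⟩
    4 ^ n * (suc h * suc h) ^ n       ≡⟨ cong (4 ^ n *_) (^-distribʳ-* n (suc h) (suc h)) ⟩
    4 ^ n * (N * N)                   ∎
  regroup₁ : ∀ f s → 2880 * 1 * (f * s) * 1 ≡ 144 * f * (20 * s)
  regroup₁ = solve-∀
  regroup₂ : ∀ f n P M → 144 * f * (3 * n * P * (M * M)) ≡ M * M * (27 * (16 * P) * n * f)
  regroup₂ = solve-∀

lhs≤ : ∀ g m (m≥4 : 4 ≤ m) n M .{{_ : NonZero n}} .{{_ : NonZero M}} → let h = suc g; N = suc h ^ n in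
  m ≡ h + h → 20 * (N * N) ≤ 3 * n * 180σ² g * (M * M) →
  C m m≥4 ÷ √ fromℕ n *ᴿ (fromℕ (2 + m) ÷ fromℕ 2) ^ᴿ n ≤ᴿ fromℕ M
lhs≤ g m m≥4 n M refl le = square-≤
  (C m m≥4 ÷ √ fromℕ n *ᴿ (fromℕ (2 + m) ÷ fromℕ 2) ^ᴿ n) (fromℕ M)
  (square-lhs m m≥4 n) (square-ℕ M) (cleared-bound g n M le)

C-bound : ∀ m (m≥4 : 4 ≤ m) → 2 ∣ m → ∀ n .{{_ : NonZero n}} → LowerBound m m≥4 (C m m≥4) n
C-bound m m≥4 2∣m n =
  let g , m≡ = even≥4 m≥4 2∣m
      N      = suc (suc (suc g)) ^ n
  in lhs≤ (suc g) m m≥4 n (r 3 m n) {{it}} {{r₃≢0 m n {{4≤⇒≢0 m≥4}}}} m≡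
       (subst (λ m → 20 * (N * N) ≤ 3 * n * 180σ² (suc g) * (r 3 m n * r 3 m n))
         (sym m≡) (square-bound (suc g) n))

-- Asymptotics of the constant

-- For m ≥ 4 the term 48m is at most 3m³, well within 8m³. Together with `2880σ²≤` this places m⁴ /
-- `2880σ² m` between m / (m + 9) and 1.
m⁴≤2880σ² : ∀ m → 4 ≤ m → m ^ 4 ≤ 2880σ² m
m⁴≤2880σ² m m≥4 = m+n≤o⇒m≤o∸n (m ^ 4) (begin
  m ^ 4 + 48 * m                  ≤⟨ +-monoʳ-≤ (m ^ 4) (*-monoˡ-≤ m (*-monoʳ-≤ 3 (*-mono-≤ m≥4 m≥4))) ⟩
  m ^ 4 + 3 * (m * m) * m         ≤⟨ m≤m+n _ (5 * (m * m) * m + 4 * m ^ 2) ⟩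
  m ^ 4 + 3 * (m * m) * m + (5 * (m * m) * m + 4 * m ^ 2)  ≡⟨ collect m (m ^ 4) (4 * m ^ 2) ⟩
  m ^ 4 + 8 * m ^ 3 + 4 * m ^ 2   ∎)
  where
  collect : ∀ m a b → a + 3 * (m * m) * m + (5 * (m * m) * m + b) ≡ a + 8 * (m * (m * (m * 1))) + b
  collect = solve-∀

-- The 9 is 8 + 1: for m ≥ 4 the term 4m² is at most one further m³.
2880σ²≤ : ∀ m → 4 ≤ m → 2880σ² m ≤ m ^ 3 * (m + 9)
2880σ²≤ m m≥4 = begin
  2880σ² m                               ≤⟨ m∸n≤m (m ^ 4 + 8 * m ^ 3 + 4 * m ^ 2) (48 * m) ⟩
  m ^ 4 + 8 * m ^ 3 + 4 * m ^ 2          ≤⟨ +-monoʳ-≤ (m ^ 4 + 8 * m ^ 3) (*-monoˡ-≤ (m ^ 2) m≥4) ⟩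
  m ^ 4 + 8 * m ^ 3 + m * m ^ 2          ≡⟨ collect m (m ^ 3) ⟩
  m ^ 3 * (m + 9)                        ∎
  where
  collect : ∀ m c → m * c + 8 * c + c ≡ c * (m + 9)
  collect = solve-∀

-- The square of `C-asymptotic` is 320 / (3m⁴), and 3 · 2880 = 27 · 320 = 8640. The squared ratio is
-- therefore m⁴ / `2880σ² m`, whose leading coefficients agree.
square-C÷C-asymptotic : ∀ m (m≥4 : 4 ≤ m) →
  SquareIs (C m m≥4 ÷ C-asymptotic m m≥4) (8640 * m ^ 4) (8640 * 2880σ² m)
square-C÷C-asymptotic m m≥4 = subst₂ (SquareIs (C m m≥4 ÷ C-asymptotic m m≥4))
  (numerator m) (denominator (2880σ² m))
  (square-÷ (C m m≥4) (C-asymptotic m m≥4) (square-C m m≥4)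
    (square-÷ (fromℕ 8 *ᴿ √ fromℕ 5) (√ fromℕ 3 *ᴿ fromℕ m ^ᴿ 2)
      (square-* (fromℕ 8) (√ fromℕ 5) (square-ℕ 8) (square-√ℕ 5))
      (square-* (√ fromℕ 3) (fromℕ m ^ᴿ 2) (square-√ℕ 3) (square-^ (fromℕ m) (square-ℕ m) 2))))
  where
  instance _ = 4≤⇒≢0 m≥4
  numerator : ∀ m → 2880 * (1 * (3 * (m * m * (m * m * 1)))) ≡ 8640 * (m * (m * (m * (m * 1))))
  numerator = solve-∀
  denominator : ∀ A → 27 * A * 320 ≡ 8640 * A
  denominator = solve-∀

module _ {ε : ℚ} (0<ε : 0ℚ ℚ.< ε) where

  threshold : ∃[ k ] ι 9 ℚ.≤ ε ℚ.* ι k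
  threshold =
    let u , 0<u , e = inv 0<ε
        k , le      = archimedean (ι 9 ℚ.* u)
    in k , subst₂ ℚ._≤_
      (trans (solve 3 (λ ε n u → ε :* (n :* u) := n :* (ε :* u)) refl ε (ι 9) u)
        (trans (cong (ι 9 ℚ.*_) e) (ℚ.*-identityʳ (ι 9))))
      (cong (ε ℚ.*_) (steps≡ι k))
      (ℚ.*-monoˡ-≤-nonNeg ε {{ℚ.pos⇒nonNeg ε {{ℚ.positive 0<ε}}}} le)

  1<1+ε : 1ℚ ℚ.< 1ℚ ℚ.+ ε
  1<1+ε = subst (ℚ._< 1ℚ ℚ.+ ε) (ℚ.+-identityʳ 1ℚ) (ℚ.+-monoʳ-< 1ℚ 0<ε)

  1-ε<1 : 1ℚ ℚ.- ε ℚ.< 1ℚ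
  1-ε<1 = subst (1ℚ ℚ.- ε ℚ.<_) (ℚ.+-identityʳ 1ℚ) (ℚ.+-monoʳ-< 1ℚ (ℚ.neg-antimono-< 0<ε))

  1<[1+ε]² : 1ℚ ℚ.< (1ℚ ℚ.+ ε) ℚ.* (1ℚ ℚ.+ ε)
  1<[1+ε]² = mono* (ℚ.positive⁻¹ 1ℚ) (ℚ.<-trans (ℚ.positive⁻¹ 1ℚ) 1<1+ε) 1<1+ε 1<1+ε

  -- One factor 1 - ε is below 1 and is dropped. The remaining (1 - ε) (m + 9) < m says 9 < ε (m +
  -- 9), which follows from 9 ≤ εk and k ≤ m.
  [1-ε]²[m+9]<m : ∀ {k m} .{{_ : NonZero m}} → ι 9 ℚ.≤ ε ℚ.* ι k → k ≤ m →
                 0ℚ ℚ.< 1ℚ ℚ.- ε → (1ℚ ℚ.- ε) ℚ.* (1ℚ ℚ.- ε) ℚ.* ι (m + 9) ℚ.< ι m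
  [1-ε]²[m+9]<m {k} {m} 9≤εk k≤m 0<t = ℚ.<-trans
    (subst (t ℚ.* t ℚ.* ι (m + 9) ℚ.<_) (cong (ℚ._* ι (m + 9)) (ℚ.*-identityʳ t))
      (monoˡ (ι-pos (m + 9) {{m+9≢0}}) (monoʳ 0<t 1-ε<1)))
    (subst₂ ℚ._<_ (sym expand) cancel (ℚ.+-monoʳ-< (ι m ℚ.+ ι 9) (ℚ.neg-antimono-< 9<)))
    where
    t = 1ℚ ℚ.- ε
    m+9≢0 : NonZero (m + 9)
    m+9≢0 = ℕ.>-nonZero (≤-trans (s≤s z≤n) (m≤n+m 9 m))
    9< : ι 9 ℚ.< ε ℚ.* (ι m ℚ.+ ι 9)
    9< = ℚ.≤-<-trans 9≤εk (ℚ.≤-<-trans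
      (ℚ.*-monoˡ-≤-nonNeg ε {{ℚ.pos⇒nonNeg ε {{ℚ.positive 0<ε}}}} (ι-mono-≤ k≤m))
      (monoʳ 0<ε (subst (ℚ._< ι m ℚ.+ ι 9) (ℚ.+-identityʳ (ι m)) (ℚ.+-monoʳ-< (ι m) (ι-pos 9)))))
    expand : t ℚ.* ι (m + 9) ≡ ι m ℚ.+ ι 9 ℚ.- ε ℚ.* (ι m ℚ.+ ι 9)
    expand = trans (cong (t ℚ.*_) (ι-+ m 9))
      (solve 2 (λ ε s → (con 1ℚ :- ε) :* s := s :- ε :* s) refl ε (ι m ℚ.+ ι 9))
    cancel : ι m ℚ.+ ι 9 ℚ.- ι 9 ≡ ι m
    cancel = solve 2 (λ a b → a :+ b :- b := a) refl (ι m) (ι 9)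

  -- The squared ratio never exceeds 1, so the upper estimate holds for all m ≥ 4; only the lower
  -- one requires m to pass the threshold, of order 9 / ε.
  C-asymptotics : ∃[ M ] (∀ m (m≥4 : 4 ≤ m) → 2 ∣ m → M ≤ m →
                  ∣ C m m≥4 ÷ C-asymptotic m m≥4 -1∣< ε)
  C-asymptotics = let k , 9≤εk = threshold in k , λ m m≥4 _ k≤m →
    let ratio = square-C÷C-asymptotic m m≥4
        instance
          m≢0 = 4≤⇒≢0 m≥4
    in (λ 0<t → lower⁻ (C m m≥4 ÷ C-asymptotic m m≥4) ratio 0<t
         (below m m≥4 0<t ([1-ε]²[m+9]<m 9≤εk k≤m 0<t)))
     , upper⁻ (C m m≥4 ÷ C-asymptotic m m≥4) ratio (ℚ.<-trans (ℚ.positive⁻¹ 1ℚ) 1<1+ε) (above m m≥4)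
    where
    below : ∀ m (m≥4 : 4 ≤ m) → 0ℚ ℚ.< 1ℚ ℚ.- ε →
      (1ℚ ℚ.- ε) ℚ.* (1ℚ ℚ.- ε) ℚ.* ι (m + 9) ℚ.< ι m →
      (1ℚ ℚ.- ε) ℚ.* (1ℚ ℚ.- ε) ℚ.* ι (8640 * 2880σ² m) ℚ.< ι (8640 * m ^ 4)
    below m m≥4 0<t lt = ℚ.≤-<-trans
      (ℚ.*-monoˡ-≤-nonNeg (t ℚ.* t) {{ℚ.pos⇒nonNeg (t ℚ.* t) {{ℚ.positive (pos* 0<t 0<t)}}}}
        (ℚ.≤-trans (ι-mono-≤ (≤-trans (*-monoʳ-≤ 8640 (2880σ²≤ m m≥4))
            (≤-reflexive (trans (sym (*-assoc 8640 (m ^ 3) (m + 9))) (*-comm c (m + 9))))))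
          (ℚ.≤-reflexive (ι-* (m + 9) c))))
      (subst₂ ℚ._<_ (ℚ.*-assoc (t ℚ.* t) (ι (m + 9)) (ι c))
        (trans (sym (ι-* m c)) (cong ι (regroup m (m ^ 3))))
        (monoˡ (ι-pos c) lt))
      where
      t = 1ℚ ℚ.- ε
      c = 8640 * m ^ 3
      instance
        _ = 4≤⇒≢0 m≥4
        _ = m^n≢0 m 3
        _ = m*n≢0 8640 (m ^ 3)
      regroup : ∀ m c → m * (8640 * c) ≡ 8640 * (m * c)
      regroup = solve-∀

    above : ∀ m (m≥4 : 4 ≤ m) →
      ι (8640 * m ^ 4) ℚ.< (1ℚ ℚ.+ ε) ℚ.* (1ℚ ℚ.+ ε) ℚ.* ι (8640 * 2880σ² m)
    above m m≥4 = ℚ.≤-<-trans (ι-mono-≤ (*-monoʳ-≤ 8640 (m⁴≤2880σ² m m≥4)))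
      (subst (ℚ._< (1ℚ ℚ.+ ε) ℚ.* (1ℚ ℚ.+ ε) ℚ.* ι s) (ℚ.*-identityˡ (ι s))
        (monoˡ (ι-pos s) 1<[1+ε]²))
      where
      s = 8640 * 2880σ² m
      instance
        _ = 2880σ²≢0 m m≥4
        _ = m*n≢0 8640 (2880σ² m)

theorem3p11 : (∀ m (m≥4 : 4 ℕ.≤ m) → 2 ∣ m →
    ∃[ c ] (∀ n .{{_ : NonZero n}} → LowerBound m m≥4 c n))
    × (∀ m (m≥4 : 4 ℕ.≤ m) → 2 ∣ m →
    ∀ n .{{_ : NonZero n}} → LowerBound m m≥4 (C m m≥4) n)
    × (∀ ε → 0ℚ ℚ.< ε → ∃[ M ] (∀ m (m≥4 : 4 ℕ.≤ m) → 2 ∣ m → M ℕ.≤ m →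
    ∣ C m m≥4 ÷ C-asymptotic m m≥4 -1∣< ε))
theorem3p11 =
  (λ m m≥4 2∣m → C m m≥4 , C-bound m m≥4 2∣m) , C-bound , λ ε 0<ε → C-asymptotics 0<ε
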